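{- There is a polynomial time algorithm which, given a graph $G$ with maximum degree three, determines whether $\overleftrightarrow{\chi}(G) \leq 2$.
   Context: All graphs are finite and simple. An orientation $D$ of a graph $G$ is a digraph obtained by replacing each edge of $G$ by exactly one of the two possible arcs with the same endvertices. For a vertex $v$, $d_D^-(v)$ (in-degree) is the number of arcs with head $v$, $d_D^+(v)$ (out-degree) is the number of arcs with tail $v$, and the in-out-degree is $d_D^{\pm}(v) = d_D^-(v) - d_D^+(v)$. An orientation $D$ of $G$ is in-out-proper if $d_D^{\pm}(u) \neq d_D^{\pm}(v)$ for any two adjacent vertices $u,v$. The in-out-proper orientation number of $G$ is $\overleftrightarrow{\chi}(G) = \min_{D\in\Gamma}\max_{v\in V(G)} |d_D^{\pm}(v)|$, where $\Gamma$ is the set of in-out-proper orientations of $G$ (it is known that $\Gamma$ is nonempty for every graph $G$). -}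

module Defs where

open import Data.Bool using (Bool; true; false; not; T)
open import Data.Fin using (Fin; zero)
open import Data.Fin.Subset using (∣_∣)
open import Data.Integer using (ℤ; _⊖_) renaming (∣_∣ to abs)
open import Data.List using (List; []; _∷_; map; allFin)
open import Data.List.Extrema.Nat using (max)
open import Data.Nat using (ℕ; suc; _+_; _*_; _^_; _≤_)
open import Data.Nat.Properties using (≤-antisym; ≤-trans; ≤-reflexive)
open import Data.Product using (Σ-syntax; ∃-syntax; _×_; _,_)
open import Data.Vec as Vec using (Vec; tabulate; lookup; replicate; _[_]≔_)
open import Relation.Binary.PropositionalEquality using (_≡_; _≢_)
open import Relation.Nullary using (Reflects)

record Graph : Set where
  field
    order       : ℕ
    adj         : Fin order → Fin order → Bool
    symmetric   : ∀ u v → adj u v ≡ adj v u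
    irreflexive : ∀ v → adj v v ≡ false

  V : Set
  V = Fin order

open Graph using (V)

count : ∀ {n} → (Fin n → Bool) → ℕ
count p = ∣ tabulate p ∣

-- The base value 0 is relevant only for the graph without vertices.
maxOver : ∀ n → (Fin n → ℕ) → ℕ
maxOver n f = max 0 (map f (allFin n))

degree : (G : Graph) → V G → ℕ
degree G v = count (Graph.adj G v)

maxDegree : Graph → ℕ
maxDegree G = maxOver (Graph.order G) (degree G)

record Orientation (G : Graph) : Set where
  open Graph G using (adj)
  field
    arc       : V G → V G → Bool          -- arc u v: tail u, head v
    arc⇒adj   : ∀ u v → T (arc u v) → T (adj u v)
    oneOfBoth : ∀ u v → T (adj u v) → arc v u ≡ not (arc u v)

open Orientation

module _ {G : Graph} (D : Orientation G) where

  inDegree : V G → ℕ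
  inDegree v = count (λ u → arc D u v)

  outDegree : V G → ℕ
  outDegree v = count (λ u → arc D v u)

  inOutDegree : V G → ℤ
  inOutDegree v = inDegree v ⊖ outDegree v

  InOutProper : Set
  InOutProper = ∀ u v → T (Graph.adj G u v) → inOutDegree u ≢ inOutDegree v

  maxInOutDegree : ℕ
  maxInOutDegree = maxOver (Graph.order G) (λ v → abs (inOutDegree v))

record IsInOutProperOrientationNumber (G : Graph) (k : ℕ) : Set where
  field
    attained : Σ[ D ∈ Orientation G ] InOutProper D × maxInOutDegree D ≡ k
    minimal  : (D : Orientation G) → InOutProper D → k ≤ maxInOutDegree D

inOutProperOrientationNumber-unique : ∀ {G j k} → IsInOutProperOrientationNumber G j →
         IsInOutProperOrientationNumber G k → j ≡ k
inOutProperOrientationNumber-unique p q with IsInOutProperOrientationNumber.attained p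
              | IsInOutProperOrientationNumber.attained q
... | D , D-proper , D≡j | E , E-proper , E≡k = ≤-antisym
  (≤-trans (IsInOutProperOrientationNumber.minimal p E E-proper) (≤-reflexive E≡k))
  (≤-trans (IsInOutProperOrientationNumber.minimal q D D-proper) (≤-reflexive D≡j))

-- The model of computation is the WHILE language of N. D. Jones (Computability
-- and Complexity from a Programming Perspective, MIT Press, 1997): imperative
-- programs with finitely many variables ranging over binary trees.  The language
-- has no tree-equality test.  Each operator evaluated and each command executed
-- costs one unit.  Unit-cost copying and `cons` are legitimate because a random
-- access machine represents values by pointers to immutable cells: every unit
-- allocates at most one cell and follows at most one pointer.  Hence polynomial
-- time here is the same as polynomial time on Turing machines.

infixr 5 _∙_
infix  6 _:=_
infix  5 if_then_else_ while_loop_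
infixr 4 _⨾_

data Tree : Set where
  nil : Tree
  _∙_ : Tree → Tree → Tree

size : Tree → ℕ
size nil     = 1
size (a ∙ b) = suc (size a + size b)

left right : Tree → Tree
left nil      = nil
left (a ∙ b)  = a
right nil     = nil
right (a ∙ b) = b

data Expr (m : ℕ) : Set where
  var   : Fin m → Expr m
  nil   : Expr m
  cons  : Expr m → Expr m → Expr m
  hd tl : Expr m → Expr m

data Cmd (m : ℕ) : Set where
  skip          : Cmd m
  _:=_          : Fin m → Expr m → Cmd m
  _⨾_           : Cmd m → Cmd m → Cmd m
  if_then_else_ : Expr m → Cmd m → Cmd m → Cmd m
  while_loop_   : Expr m → Cmd m → Cmd m

Store : ℕ → Set
Store m = Vec Tree m

eval : ∀ {m} → Expr m → Store m → Tree
eval (var x)    s = lookup s x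
eval nil        s = nil
eval (cons e f) s = eval e s ∙ eval f s
eval (hd e)     s = left (eval e s)
eval (tl e)     s = right (eval e s)

cost : ∀ {m} → Expr m → ℕ
cost (var x)    = 1
cost nil        = 1
cost (cons e f) = suc (cost e + cost f)
cost (hd e)     = suc (cost e)
cost (tl e)     = suc (cost e)

-- ⟨ c , s ⟩⇓ s′ [ t ]: started in store s, command c halts in store s′ after
-- exactly t units of time.  The tree nil counts as false in tests, all others
-- as true.
data ⟨_,_⟩⇓_[_] {m : ℕ} : Cmd m → Store m → Store m → ℕ → Set where
  skip : ∀ {s} →
         ⟨ skip , s ⟩⇓ s [ 1 ]
  assign : ∀ {s x e} →
           ⟨ x := e , s ⟩⇓ (s [ x ]≔ eval e s) [ suc (cost e) ]
  seq : ∀ {s s′ s″ c d t t′} →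
        ⟨ c , s ⟩⇓ s′ [ t ] →
        ⟨ d , s′ ⟩⇓ s″ [ t′ ] →
        ⟨ c ⨾ d , s ⟩⇓ s″ [ suc (t + t′) ]
  if-true : ∀ {s s′ e c d t} →
            eval e s ≢ nil →
            ⟨ c , s ⟩⇓ s′ [ t ] →
            ⟨ if e then c else d , s ⟩⇓ s′ [ suc (cost e + t) ]
  if-false : ∀ {s s′ e c d t} →
             eval e s ≡ nil →
             ⟨ d , s ⟩⇓ s′ [ t ] →
             ⟨ if e then c else d , s ⟩⇓ s′ [ suc (cost e + t) ]
  while-true : ∀ {s s′ s″ e c t t′} →
               eval e s ≢ nil →
               ⟨ c , s ⟩⇓ s′ [ t ] →
               ⟨ while e loop c , s′ ⟩⇓ s″ [ t′ ] →
               ⟨ while e loop c , s ⟩⇓ s″ [ suc (cost e + (t + t′)) ]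
  while-false : ∀ {s e c} →
                eval e s ≡ nil →
                ⟨ while e loop c , s ⟩⇓ s [ suc (cost e) ]

-- Variable zero holds the input at the start and the output at the end; the
-- other variables are initially nil.
record Program : Set where
  field
    locals : ℕ
    body   : Cmd (suc locals)

HaltsWith : Program → Tree → Tree → ℕ → Set
HaltsWith P input output t =
  Σ[ s ∈ Store (suc locals) ]
    ⟨ body , input Vec.∷ replicate locals nil ⟩⇓ s [ t ] × lookup s zero ≡ output
  where open Program P

encodeBool : Bool → Tree
encodeBool false = nil
encodeBool true  = nil ∙ nil

encodeList : List Tree → Tree
encodeList []       = nil
encodeList (x ∷ xs) = x ∙ encodeList xs

-- The adjacency matrix, as the list of its rows.
encodeGraph : Graph → Tree
encodeGraph G = encodeList (map row (allFin order))
  where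
  open Graph G
  row : Fin order → Tree
  row u = encodeList (map (λ v → encodeBool (adj u v)) (allFin order))

-- A single program, with a time bound polynomial in the size of the input,
-- that decides Property for all graphs of the given Class.
PolynomialTimeDecidable : (Class Property : Graph → Set) → Set
PolynomialTimeDecidable Class Property =
  Σ[ P ∈ Program ] ∃[ c ] ∃[ d ] ((G : Graph) → Class G →
    Σ[ answer ∈ Bool ] ∃[ t ]
      HaltsWith P (encodeGraph G) (encodeBool answer) t ×
      t ≤ c * size (encodeGraph G) ^ d + c ×
      Reflects (Property G) answer)

{-# OPTIONS --safe #-}
module Submission where

-- All vertices of odd degree must get the values ±1, so the subgraph H induced
-- on them has to be 2-coloured by the signs.  At a vertex of degree three the
-- sign says whether it has one outgoing or one incoming "minor" arc; a minor arc
-- between two vertices of degree three is minor for both, and a leaf has none.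
-- Hence the minor arcs inside H form a matching of the vertices of degree three
-- covering all those without a neighbour of even degree.  As H is bipartite,
-- such a matching is the same as a permutation f of all vertices for which
-- every v either has f v adjacent, both of degree three, or f v ≡ v and v is
-- not forced to be covered.  Conversely a sign colouring and a permutation
-- always suffice: vertices of degree two take care of themselves, because
-- reversing an arc between two of them with value 0 gives them the values ±2.
--
-- The colouring is found by merging labels, the permutation by an auction.  All
-- loops of these algorithms run over the vertices, and every program with this
-- property takes polynomial time.

-- The values ±1 are forced by parity: in-degree minus out-degree is congruent to the degree modulo
-- two. A matching yields an involution, hence a permutation. Conversely, every cycle of the
-- permutation that is not a fixed point alternates between the two colours, so keeping every second
-- edge of it leaves a matching of the same vertices. Fixed points, allowed where covering is
-- optional, thus turn the covering of a prescribed set into a perfect matching between two copies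
-- of the vertex set, which can be sought without regard to the colouring. An auction needs no
-- search for augmenting paths: a bid is one local update, and the sum of the prices bounds the
-- number of bids in advance. This suits a language whose loops have a number of rounds fixed
-- beforehand.

open import Defs
open import Data.Bool using (Bool; true; false; not; _∧_; _∨_; _xor_; T)
  renaming (if_then_else_ to when_then_else_)
import Data.Bool.Properties as Bool
open import Data.Bool.Properties using (T-∧; T-∨; T-≡; ¬-not; xor-assoc; T?)
open import Data.Empty using (⊥-elim)
open import Data.Fin as Fin using (Fin; zero; suc; toℕ; inject₁; fromℕ; punchOut; combine; remQuot)
import Data.Fin.Properties as Fin
open import Data.Fin.Subset using (Subset; ∣_∣)
open import Data.Fin.Subset.Properties using (anySubset?)
open import Data.Integer using (ℤ; -_; _⊖_; +_; -[1+_]) renaming (∣_∣ to abs)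
import Data.Integer.Properties as ℤ
open import Data.List as List using (List; []; _∷_)
open import Data.List.Extrema.Nat using (max≤v⁺; xs≤max)
open import Data.List.Properties using (map-tabulate; tabulate-cong; length-tabulate)
import Data.List.Relation.Unary.All.Properties as All
open import Data.Nat
  using (ℕ; zero; suc; _+_; _*_; _^_; _≤_; _<_; z≤n; s≤s; z<s; _≡ᵇ_; _<ᵇ_; _≤?_; >-nonZero)
open import Data.Nat.Properties
open import Data.Product using (Σ-syntax; ∃-syntax; _×_; _,_; proj₁; proj₂)
open import Data.Sum using (_⊎_; inj₁; inj₂; [_,_]′)
open import Data.Unit using (⊤; tt)
open import Data.Vec as Vec using (lookup; tabulate; _[_]≔_)
import Data.Vec.Properties as Vec
open import Function using (_∘_; id; Injective)
open import Function.Bundles using (Equivalence)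
open import Relation.Binary.PropositionalEquality
open import Relation.Nullary using (¬_; ¬?; Dec; yes; no; Reflects)
open import Relation.Nullary.Decidable using (_×-dec_; _→-dec_; map′)
open import Relation.Nullary.Reflects using (fromEquivalence)

open Equivalence using (to; from)

-- Polynomial time bounds for WHILE programs

infixl 6 _⊕_
infixl 7 _⊛_

-- A bound has to be read off the program text before the input is known, hence polynomials as
-- syntax.
data Poly : Set where
  con      : ℕ → Poly
  X        : Poly
  _⊕_ _⊛_ : Poly → Poly → Poly

⟦_⟧ᵖ : Poly → ℕ → ℕ
⟦ con k ⟧ᵖ n = k
⟦ X ⟧ᵖ n     = n
⟦ p ⊕ q ⟧ᵖ n = ⟦ p ⟧ᵖ n + ⟦ q ⟧ᵖ n
⟦ p ⊛ q ⟧ᵖ n = ⟦ p ⟧ᵖ n * ⟦ q ⟧ᵖ n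

⟦_⟧ᵖ-mono : ∀ p {m n} → m ≤ n → ⟦ p ⟧ᵖ m ≤ ⟦ p ⟧ᵖ n
⟦ con k ⟧ᵖ-mono m≤n = ≤-refl
⟦ X ⟧ᵖ-mono m≤n     = m≤n
⟦ p ⊕ q ⟧ᵖ-mono m≤n = +-mono-≤ (⟦ p ⟧ᵖ-mono m≤n) (⟦ q ⟧ᵖ-mono m≤n)
⟦ p ⊛ q ⟧ᵖ-mono m≤n = *-mono-≤ (⟦ p ⟧ᵖ-mono m≤n) (⟦ q ⟧ᵖ-mono m≤n)

-- A sum needs a common exponent; `d + d′` is one because `1 ≤ n`, and for a product it is the exact
-- one.
⟦_⟧ᵖ-≤-monomial : ∀ p → ∃[ c ] ∃[ d ] (∀ n → 1 ≤ n → ⟦ p ⟧ᵖ n ≤ c * n ^ d)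
⟦ con k ⟧ᵖ-≤-monomial = k , 0 , λ n _ → ≤-reflexive (sym (*-identityʳ k))
⟦ X ⟧ᵖ-≤-monomial     = 1 , 1 , λ n _ → ≤-reflexive (sym (trans (*-identityˡ (n ^ 1)) (*-identityʳ n)))
⟦ p ⊕ q ⟧ᵖ-≤-monomial with ⟦ p ⟧ᵖ-≤-monomial | ⟦ q ⟧ᵖ-≤-monomial
... | c , d , p≤ | c′ , d′ , q≤ = c + c′ , d + d′ , sum≤
  where
  open ≤-Reasoning
  sum≤ : ∀ n → 1 ≤ n → _
  sum≤ n 1≤n = begin
    ⟦ p ⟧ᵖ n + ⟦ q ⟧ᵖ n                  ≤⟨ +-mono-≤ (p≤ n 1≤n) (q≤ n 1≤n) ⟩
    c * n ^ d + c′ * n ^ d′              ≤⟨ +-mono-≤ (*-monoʳ-≤ c (^-monoʳ-≤ n (m≤m+n d d′)))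
                                                     (*-monoʳ-≤ c′ (^-monoʳ-≤ n (m≤n+m d′ d))) ⟩
    c * n ^ (d + d′) + c′ * n ^ (d + d′) ≡⟨ *-distribʳ-+ (n ^ (d + d′)) c c′ ⟨
    (c + c′) * n ^ (d + d′)              ∎
    where instance _ = >-nonZero 1≤n
⟦ p ⊛ q ⟧ᵖ-≤-monomial with ⟦ p ⟧ᵖ-≤-monomial | ⟦ q ⟧ᵖ-≤-monomial
... | c , d , p≤ | c′ , d′ , q≤ = c * c′ , d + d′ , product≤
  where
  open ≤-Reasoning
  product≤ : ∀ n → 1 ≤ n → _
  product≤ n 1≤n = begin
    ⟦ p ⟧ᵖ n * ⟦ q ⟧ᵖ n         ≤⟨ *-mono-≤ (p≤ n 1≤n) (q≤ n 1≤n) ⟩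
    c * n ^ d * (c′ * n ^ d′)   ≡⟨ [m*n]*[o*p]≡[m*o]*[n*p] c (n ^ d) c′ (n ^ d′) ⟩
    c * c′ * (n ^ d * n ^ d′)   ≡⟨ cong (c * c′ *_) (^-distribˡ-+-* n d d′) ⟨
    c * c′ * n ^ (d + d′)       ∎

-- An upper bound for the running time, valid as long as no while loop is
-- iterated more than X times.
bound : ∀ {m} → Cmd m → Poly
bound skip                 = con 1
bound (x := e)             = con (suc (cost e))
bound (c ⨾ d)              = con 1 ⊕ (bound c ⊕ bound d)
bound (if e then c else d) = con (suc (cost e)) ⊕ (bound c ⊕ bound d)
bound (while e loop c)     = (con 1 ⊕ X) ⊛ (con (suc (cost e)) ⊕ bound c)

record Runs {m} (n : ℕ) (c : Cmd m) (st st′ : Store m) : Set where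
  constructor runs
  field
    {time}    : ℕ
    execution : ⟨ c , st ⟩⇓ st′ [ time ]
    time≤     : time ≤ ⟦ bound c ⟧ᵖ n

data Iterates {m} (n : ℕ) (e : Expr m) (c : Cmd m) : ℕ → Store m → Store m → Set where
  done  : ∀ {st} → eval e st ≡ nil → Iterates n e c 0 st st
  again : ∀ {k st st′ st″} → eval e st ≢ nil → Runs n c st st′ →
          Iterates n e c k st′ st″ → Iterates n e c (suc k) st st″

module _ {m n : ℕ} where

  runs-:= : ∀ {st : Store m} {x e} → Runs n (x := e) st (st [ x ]≔ eval e st)
  runs-:= = runs assign ≤-refl

  infixr 4 _⨾⟱_

  _⨾⟱_ : ∀ {st st′ st″ : Store m} {c d} → Runs n c st st′ → Runs n d st′ st″ →
         Runs n (c ⨾ d) st st″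
  runs c⇓ ≤c ⨾⟱ runs d⇓ ≤d = runs (seq c⇓ d⇓) (s≤s (+-mono-≤ ≤c ≤d))

  runs-then : ∀ {st st′ : Store m} {e c d} → eval e st ≢ nil → Runs n c st st′ →
              Runs n (if e then c else d) st st′
  runs-then {e = e} e≢ (runs c⇓ ≤c) =
    runs (if-true e≢ c⇓) (s≤s (+-monoʳ-≤ (cost e) (≤-trans ≤c (m≤m+n _ _))))

  runs-else : ∀ {st st′ : Store m} {e c d} → eval e st ≡ nil → Runs n d st st′ →
              Runs n (if e then c else d) st st′
  runs-else {e = e} e≡ (runs d⇓ ≤d) =
    runs (if-false e≡ d⇓) (s≤s (+-monoʳ-≤ (cost e) (≤-trans ≤d (m≤n+m _ _))))

  -- The final, failing test is charged like a full round, hence the factor `suc k`.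
  iterates⇓ : ∀ {e c k} {st st′ : Store m} → Iterates n e c k st st′ →
              ∃[ t ] (⟨ while e loop c , st ⟩⇓ st′ [ t ] ×
                      t ≤ suc k * (suc (cost e) + ⟦ bound c ⟧ᵖ n))
  iterates⇓ {e} {c} (done e≡) =
    _ , while-false e≡ , ≤-trans (m≤m+n (suc (cost e)) (⟦ bound c ⟧ᵖ n)) (m≤m+n _ 0)
  iterates⇓ {e} (again e≢ (runs c⇓ ≤c) it) with iterates⇓ it
  ... | _ , w⇓ , ≤w = _ , while-true e≢ c⇓ w⇓ ,
    ≤-trans (≤-reflexive (cong suc (sym (+-assoc (cost e) _ _))))
            (+-mono-≤ (s≤s (+-monoʳ-≤ (cost e) ≤c)) ≤w)

  runs-while : ∀ {e c k} {st st′ : Store m} → k ≤ n → Iterates n e c k st st′ →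
               Runs n (while e loop c) st st′
  runs-while k≤n it with iterates⇓ it
  ... | _ , w⇓ , ≤w = runs w⇓ (≤-trans ≤w (*-monoˡ-≤ _ (s≤s k≤n)))

  runs-≡ : ∀ {c} {st st′ st″ : Store m} → Runs n c st st′ → st′ ≡ st″ → Runs n c st st″
  runs-≡ run refl = run

-- A typed language compiled to WHILE

infixr 7 _⊗_

data Ty : Set where
  bit idx num : Ty
  arr         : Ty → Ty
  _⊗_         : Ty → Ty → Ty

⟦_⟧ᵗ : Ty → ℕ → Set
⟦ bit ⟧ᵗ n   = Bool
⟦ idx ⟧ᵗ n   = Fin n
⟦ num ⟧ᵗ n   = ℕ
⟦ arr τ ⟧ᵗ n = Fin n → ⟦ τ ⟧ᵗ n
⟦ σ ⊗ τ ⟧ᵗ n = ⟦ σ ⟧ᵗ n × ⟦ τ ⟧ᵗ n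

Cxt : Set
Cxt = List Ty

⟦_⟧ᶜ : Cxt → ℕ → Set
⟦ [] ⟧ᶜ n    = ⊤
⟦ τ ∷ Γ ⟧ᶜ n = ⟦ τ ⟧ᵗ n × ⟦ Γ ⟧ᶜ n

infix 4 _∋_

data _∋_ : Cxt → Ty → Set where
  here  : ∀ {Γ τ} → τ ∷ Γ ∋ τ
  there : ∀ {Γ σ τ} → Γ ∋ τ → σ ∷ Γ ∋ τ

-- Iteration is only over the indices, and a number is compared only with an index. So no while loop
-- of compiled code exceeds n rounds, and no bound on the numbers themselves has to be maintained.
-- `call` discards the environment: subroutines live in a context with one variable and are reused
-- without weakening.
data Tm (Γ : Cxt) : Ty → Set where
  `       : ∀ {τ} → Γ ∋ τ → Tm Γ τ
  bool    : Bool → Tm Γ bit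
  op      : (Bool → Bool → Bool) → Tm Γ bit → Tm Γ bit → Tm Γ bit
  cond    : ∀ {τ} → Tm Γ bit → Tm Γ τ → Tm Γ τ → Tm Γ τ
  pair    : ∀ {σ τ} → Tm Γ σ → Tm Γ τ → Tm Γ (σ ⊗ τ)
  fst     : ∀ {σ τ} → Tm Γ (σ ⊗ τ) → Tm Γ σ
  snd     : ∀ {σ τ} → Tm Γ (σ ⊗ τ) → Tm Γ τ
  bind    : ∀ {σ τ} → Tm Γ σ → Tm (σ ∷ Γ) τ → Tm Γ τ
  call    : ∀ {σ τ} → Tm (σ ∷ []) τ → Tm Γ σ → Tm Γ τ
  zeroᵗ   : Tm Γ num
  sucᵗ    : Tm Γ num → Tm Γ num
  toNum   : Tm Γ idx → Tm Γ num
  equal   : Tm Γ num → Tm Γ idx → Tm Γ bit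
  _!_     : ∀ {τ} → Tm Γ (arr τ) → Tm Γ idx → Tm Γ τ
  table   : ∀ {τ} → Tm (idx ∷ Γ) τ → Tm Γ (arr τ)
  loop    : ∀ {τ} → Tm Γ τ → Tm (idx ∷ τ ∷ Γ) τ → Tm Γ τ

infixl 9 _!_

-- A right fold, in which the last index acts first: a unary counter that is decremented before each
-- round passes through the indices in this order.
foldFin : ∀ {a} {A : Set a} {n} → (Fin n → A → A) → A → A
foldFin {n = zero}  f a = a
foldFin {n = suc n} f a = f zero (foldFin (f ∘ suc) a)

find : ∀ {n Γ τ} → Γ ∋ τ → ⟦ Γ ⟧ᶜ n → ⟦ τ ⟧ᵗ n
find here      (v , _) = v
find (there x) (_ , ρ) = find x ρ

⟦_⟧ : ∀ {n Γ τ} → Tm Γ τ → ⟦ Γ ⟧ᶜ n → ⟦ τ ⟧ᵗ n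
⟦ ` x ⟧ ρ        = find x ρ
⟦ bool b ⟧ ρ     = b
⟦ op f t u ⟧ ρ   = f (⟦ t ⟧ ρ) (⟦ u ⟧ ρ)
⟦ cond t u v ⟧ ρ = when ⟦ t ⟧ ρ then ⟦ u ⟧ ρ else ⟦ v ⟧ ρ
⟦ pair t u ⟧ ρ   = ⟦ t ⟧ ρ , ⟦ u ⟧ ρ
⟦ fst t ⟧ ρ      = proj₁ (⟦ t ⟧ ρ)
⟦ snd t ⟧ ρ      = proj₂ (⟦ t ⟧ ρ)
⟦ bind t u ⟧ ρ   = ⟦ u ⟧ (⟦ t ⟧ ρ , ρ)
⟦ call t u ⟧ ρ   = ⟦ t ⟧ (⟦ u ⟧ ρ , tt)
⟦ zeroᵗ ⟧ ρ      = 0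
⟦ sucᵗ t ⟧ ρ     = suc (⟦ t ⟧ ρ)
⟦ toNum t ⟧ ρ    = toℕ (⟦ t ⟧ ρ)
⟦ equal t u ⟧ ρ  = ⟦ t ⟧ ρ ≡ᵇ toℕ (⟦ u ⟧ ρ)
⟦ t ! u ⟧ ρ      = ⟦ t ⟧ ρ (⟦ u ⟧ ρ)
⟦ table t ⟧ ρ    = λ i → ⟦ t ⟧ (i , ρ)
⟦ loop t u ⟧ ρ   = foldFin (λ i a → ⟦ u ⟧ (i , a , ρ)) (⟦ t ⟧ ρ)

-- valᵣ holds the value of the last evaluated term, envᵣ the environment, stkᵣ a
-- stack and lenᵣ the number of indices in unary.
pattern valᵣ = zero
pattern envᵣ = suc zero
pattern stkᵣ = suc (suc zero)
pattern lenᵣ = suc (suc (suc zero))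

Code : Set
Code = Cmd 4

val env stk len : Expr 4
val = var valᵣ
env = var envᵣ
stk = var stkᵣ
len = var lenᵣ

push pop : Code
push = stkᵣ := cons val stk
pop  = stkᵣ := tl stk

access : ∀ {Γ τ} → Γ ∋ τ → Expr 4 → Expr 4
access here      ρ = hd ρ
access (there x) ρ = access x (tl ρ)

boolE : Bool → Expr 4
boolE false = nil
boolE true  = cons nil nil

pairing : Code → Code → Code
pairing c d = c ⨾ push ⨾ d ⨾ valᵣ := cons (hd stk) val ⨾ pop

-- For `compareStep`, `val` is the pair of the index and the number. Both are decremented until the
-- index is used up; the remainder is then nil exactly if they were equal. If the number runs out
-- first, clearing the index stops the loop, and a remainder other than nil records the inequality.
compareStep lookupStep : Code
compareStep = if tl val then valᵣ := cons (tl (hd val)) (tl (tl val)) else valᵣ := cons nil (boolE true)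
lookupStep  = valᵣ := tl val ⨾ stkᵣ := cons (tl (hd stk)) (tl stk)

-- The top of the stack is a counter; below it a table keeps its finished part.
tableStep loopStep : Code → Code
tableStep c =
  stkᵣ := cons (tl (hd stk)) (tl stk) ⨾ envᵣ := cons (hd stk) env ⨾ c ⨾ envᵣ := tl env ⨾
  stkᵣ := cons (hd stk) (cons (cons val (hd (tl stk))) (tl (tl stk)))
loopStep c =
  stkᵣ := cons (tl (hd stk)) (tl stk) ⨾ envᵣ := cons (hd stk) (cons val env) ⨾ c ⨾ envᵣ := tl (tl env)

compile : ∀ {Γ τ} → Tm Γ τ → Code
compile (` x)        = valᵣ := access x env
compile (bool b)     = valᵣ := boolE b
compile (op f t u)   = pairing (compile t) (compile u) ⨾
  if hd val then (if tl val then valᵣ := boolE (f true true)  else valᵣ := boolE (f true false))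
            else (if tl val then valᵣ := boolE (f false true) else valᵣ := boolE (f false false))
compile (cond t u v) = compile t ⨾ if val then compile u else compile v
compile (pair t u)   = pairing (compile t) (compile u)
compile (fst t)      = compile t ⨾ valᵣ := hd val
compile (snd t)      = compile t ⨾ valᵣ := tl val
compile (bind t u)   = compile t ⨾ envᵣ := cons val env ⨾ compile u ⨾ envᵣ := tl env
compile (call t u)   =
  compile u ⨾ stkᵣ := cons env stk ⨾ envᵣ := cons val nil ⨾ compile t ⨾ envᵣ := hd stk ⨾ pop
compile zeroᵗ        = valᵣ := nil
compile (sucᵗ t)     = compile t ⨾ valᵣ := cons nil val
compile (toNum t)    = compile t
compile (equal t u)  = pairing (compile u) (compile t) ⨾
  while hd val loop compareStep ⨾
  if tl val then valᵣ := boolE false else valᵣ := boolE true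
compile (t ! u)      = compile t ⨾ push ⨾ compile u ⨾
  while val loop lookupStep ⨾
  valᵣ := hd (hd stk) ⨾ pop
compile (table t)    = stkᵣ := cons len (cons nil stk) ⨾
  while hd stk loop tableStep (compile t) ⨾
  valᵣ := hd (tl stk) ⨾ stkᵣ := tl (tl stk)
compile (loop t u)   = compile t ⨾ stkᵣ := cons len stk ⨾
  while hd stk loop loopStep (compile u) ⨾
  pop

-- Correctness of the compiler

unary : ℕ → Tree
unary zero    = nil
unary (suc k) = nil ∙ unary k

enc : ∀ {n} τ → ⟦ τ ⟧ᵗ n → Tree
enc bit     b       = encodeBool b
enc idx     i       = unary (toℕ i)
enc num     k       = unary k
enc (arr τ) f       = encodeList (List.tabulate (enc τ ∘ f))
enc (σ ⊗ τ) (v , w) = enc σ v ∙ enc τ w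

encᶜ : ∀ {n} Γ → ⟦ Γ ⟧ᶜ n → Tree
encᶜ []      _       = nil
encᶜ (τ ∷ Γ) (v , ρ) = enc τ v ∙ encᶜ Γ ρ

pattern state a b c d = a Vec.∷ b Vec.∷ c Vec.∷ d Vec.∷ Vec.[]

eval-access : ∀ {n Γ τ} (x : Γ ∋ τ) (ρ : ⟦ Γ ⟧ᶜ n) f st → eval f st ≡ encᶜ Γ ρ →
              eval (access x f) st ≡ enc τ (find x ρ)
eval-access here      ρ f st eq = cong left eq
eval-access (there x) ρ f st eq = eval-access x (proj₂ ρ) (tl f) st (cong right eq)

eval-boolE : ∀ b st → eval (boolE b) st ≡ encodeBool b
eval-boolE false st = refl
eval-boolE true  st = refl

-- Peels the values of f off from the last one, in the order in which a compiled
-- table computes them.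
snocFin : ∀ {m} → (Fin m → Tree) → Tree → Tree
snocFin {zero}  f o = o
snocFin {suc m} f o = snocFin (f ∘ inject₁) (f (fromℕ m) ∙ o)

snocFin-front : ∀ {m} (f : Fin (suc m) → Tree) o → snocFin f o ≡ f zero ∙ snocFin (f ∘ suc) o
snocFin-front {zero}  f o = refl
snocFin-front {suc m} f o = snocFin-front (f ∘ inject₁) (f (fromℕ (suc m)) ∙ o)

snocFin-nil : ∀ {m} (f : Fin m → Tree) → snocFin f nil ≡ encodeList (List.tabulate f)
snocFin-nil {zero}  f = refl
snocFin-nil {suc m} f = trans (snocFin-front f nil) (cong (f zero ∙_) (snocFin-nil (f ∘ suc)))

foldFin-last : ∀ {a} {A : Set a} {m} (f : Fin (suc m) → A → A) x →
               foldFin f x ≡ foldFin (f ∘ inject₁) (f (fromℕ m) x)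
foldFin-last {m = zero}  f x = refl
foldFin-last {m = suc m} f x = cong (f zero) (foldFin-last (f ∘ suc) x)

module _ (n : ℕ) where

  -- The old value `a` and the stack `w` are arbitrary, since subterms run while intermediate
  -- results lie on the stack, which they must leave intact.
  Correct : ∀ {Γ τ} → Tm Γ τ → Set
  Correct {Γ} {τ} t = ∀ (ρ : ⟦ Γ ⟧ᶜ n) a w →
    Runs n (compile t) (state a (encᶜ Γ ρ) w (unary n))
                       (state (enc τ (⟦ t ⟧ ρ)) (encᶜ Γ ρ) w (unary n))

  -- Allows an induction over the first m indices while the term keeps its meaning over all n.
  Restricts : ∀ {m} → (Fin m → Fin n) → Set
  Restricts g = ∀ i → toℕ (g i) ≡ toℕ i

  restricts-inject₁ : ∀ {m} (g : Fin (suc m) → Fin n) → Restricts g → Restricts (g ∘ inject₁)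
  restricts-inject₁ g g≗ i = trans (g≗ (inject₁ i)) (Fin.toℕ-inject₁ i)

  last≡ : ∀ {m} (g : Fin (suc m) → Fin n) → Restricts g → unary m ≡ unary (toℕ (g (fromℕ m)))
  last≡ {m} g g≗ = cong unary (sym (trans (g≗ (fromℕ m)) (Fin.toℕ-fromℕ m)))

  runs-pairing : ∀ {Γ σ τ} {t : Tm Γ σ} {u : Tm Γ τ} → Correct t → Correct u →
    ∀ (ρ : ⟦ Γ ⟧ᶜ n) a w →
    Runs n (pairing (compile t) (compile u)) (state a (encᶜ Γ ρ) w (unary n))
      (state (enc σ (⟦ t ⟧ ρ) ∙ enc τ (⟦ u ⟧ ρ)) (encᶜ Γ ρ) w (unary n))
  runs-pairing t✓ u✓ ρ a w = t✓ ρ a w ⨾⟱ runs-:= ⨾⟱ u✓ ρ _ _ ⨾⟱ runs-:= ⨾⟱ runs-:=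

  table-iterates : ∀ {Γ τ} {t : Tm (idx ∷ Γ) τ} → Correct t → (ρ : ⟦ Γ ⟧ᶜ n) →
    ∀ m (g : Fin m → Fin n) → Restricts g → ∀ o a w →
    ∃[ b ] Iterates n (hd stk) (tableStep (compile t)) m
      (state a (encᶜ Γ ρ) (unary m ∙ o ∙ w) (unary n))
      (state b (encᶜ Γ ρ) (nil ∙ snocFin (λ i → enc τ (⟦ t ⟧ (g i , ρ))) o ∙ w) (unary n))
  table-iterates t✓ ρ zero    g g≗ o a w = _ , done refl
  table-iterates {t = t} t✓ ρ (suc m) g g≗ o a w =
    _ , again (λ ())
      (runs-:= ⨾⟱
       runs-≡ runs-:= (cong (λ k → state a (k ∙ encᶜ _ ρ) (unary m ∙ o ∙ w) (unary n)) (last≡ g g≗)) ⨾⟱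
       t✓ (g (fromℕ m) , ρ) _ _ ⨾⟱ runs-:= ⨾⟱ runs-:=)
      (proj₂ (table-iterates {t = t} t✓ ρ m (g ∘ inject₁) (restricts-inject₁ g g≗) _ _ w))

  loop-iterates : ∀ {Γ τ} {u : Tm (idx ∷ τ ∷ Γ) τ} → Correct u → (ρ : ⟦ Γ ⟧ᶜ n) →
    ∀ m (g : Fin m → Fin n) → Restricts g → ∀ v w →
    Iterates n (hd stk) (loopStep (compile u)) m
      (state (enc τ v) (encᶜ Γ ρ) (unary m ∙ w) (unary n))
      (state (enc τ (foldFin (λ i x → ⟦ u ⟧ (g i , x , ρ)) v)) (encᶜ Γ ρ) (nil ∙ w) (unary n))
  loop-iterates u✓ ρ zero    g g≗ v w = done refl
  loop-iterates {τ = τ} {u} u✓ ρ (suc m) g g≗ v w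
    rewrite foldFin-last (λ i x → ⟦ u ⟧ (g i , x , ρ)) v =
    again (λ ())
      (runs-:= ⨾⟱
       runs-≡ runs-:= (cong (λ k → state (enc τ v) (k ∙ enc τ v ∙ encᶜ _ ρ) (unary m ∙ w) (unary n)) (last≡ g g≗)) ⨾⟱
       u✓ (g (fromℕ m) , v , ρ) _ _ ⨾⟱ runs-:=)
      (loop-iterates {u = u} u✓ ρ m (g ∘ inject₁) (restricts-inject₁ g g≗) _ w)

  lookup-iterates : ∀ {m} (f : Fin m → Tree) (i : Fin m) ρ w →
    ∃[ xs ] (Iterates n val lookupStep (toℕ i)
      (state (unary (toℕ i)) ρ (encodeList (List.tabulate f) ∙ w) (unary n))
      (state nil ρ ((f i ∙ xs) ∙ w) (unary n)))
  lookup-iterates f zero    ρ w = _ , done refl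
  lookup-iterates f (suc i) ρ w = _ , again (λ ()) (runs-:= ⨾⟱ runs-:=)
    (proj₂ (lookup-iterates (f ∘ suc) i ρ w))

  isNil : Tree → Bool
  isNil nil     = true
  isNil (_ ∙ _) = false

  equal-iterates : ∀ i k ρ w →
    ∃[ d ] ∃[ j ] (j ≤ i × isNil d ≡ (k ≡ᵇ i) ×
    Iterates n (hd val)
      compareStep j
      (state (unary i ∙ unary k) ρ w (unary n))
      (state (nil ∙ d) ρ w (unary n)))
  equal-iterates zero    zero    ρ w = _ , 0 , z≤n , refl , done refl
  equal-iterates zero    (suc k) ρ w = _ , 0 , z≤n , refl , done refl
  equal-iterates (suc i) zero    ρ w =
    _ , 1 , s≤s z≤n , refl , again (λ ()) (runs-else refl runs-:=) (done refl)
  equal-iterates (suc i) (suc k) ρ w with equal-iterates i k ρ w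
  ... | d , j , j≤i , d≡ , it =
    d , suc j , s≤s j≤i , d≡ , again (λ ()) (runs-then (λ ()) runs-:=) it

  runs-boolE : ∀ b {a ρ w} → Runs n (valᵣ := boolE b) (state a ρ w (unary n))
                                   (state (encodeBool b) ρ w (unary n))
  runs-boolE b = runs-≡ runs-:= (cong (λ x → state x _ _ _) (eval-boolE b _))

  correct : ∀ {Γ τ} (t : Tm Γ τ) → Correct t
  correct (` x) ρ a w = runs-≡ runs-:= (cong (λ v → state v _ _ _) (eval-access x ρ env _ refl))
  correct (bool b) ρ a w = runs-boolE b
  correct (op f t u) ρ a w with ⟦ t ⟧ ρ | ⟦ u ⟧ ρ | runs-pairing {t = t} {u} (correct t) (correct u) ρ a w
  ... | true  | true  | run = run ⨾⟱ runs-then (λ ()) (runs-then (λ ()) (runs-boolE (f true true)))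
  ... | true  | false | run = run ⨾⟱ runs-then (λ ()) (runs-else refl (runs-boolE (f true false)))
  ... | false | true  | run = run ⨾⟱ runs-else refl (runs-then (λ ()) (runs-boolE (f false true)))
  ... | false | false | run = run ⨾⟱ runs-else refl (runs-else refl (runs-boolE (f false false)))
  correct (cond t u v) ρ a w with ⟦ t ⟧ ρ | correct t ρ a w
  ... | true  | run = run ⨾⟱ runs-then (λ ()) (correct u ρ _ w)
  ... | false | run = run ⨾⟱ runs-else refl (correct v ρ _ w)
  correct (pair t u) = runs-pairing {t = t} {u} (correct t) (correct u)
  correct (fst t) ρ a w = correct t ρ a w ⨾⟱ runs-:=
  correct (snd t) ρ a w = correct t ρ a w ⨾⟱ runs-:=
  correct (bind t u) ρ a w =
    correct t ρ a w ⨾⟱ runs-:= ⨾⟱ correct u (⟦ t ⟧ ρ , ρ) _ w ⨾⟱ runs-:=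
  correct (call t u) ρ a w =
    correct u ρ a w ⨾⟱ runs-:= ⨾⟱ runs-:= ⨾⟱ correct t (⟦ u ⟧ ρ , tt) _ _ ⨾⟱ runs-:= ⨾⟱ runs-:=
  correct zeroᵗ ρ a w = runs-:=
  correct (sucᵗ t) ρ a w = correct t ρ a w ⨾⟱ runs-:=
  correct (toNum t) = correct t
  correct (equal t u) ρ a w with equal-iterates (toℕ (⟦ u ⟧ ρ)) (⟦ t ⟧ ρ) (encᶜ _ ρ) w
  ... | d , j , j≤i , d≡ , it rewrite sym d≡ =
    runs-pairing {t = u} {t} (correct u) (correct t) ρ a w ⨾⟱
    runs-while (≤-trans j≤i (Fin.toℕ≤n (⟦ u ⟧ ρ))) it ⨾⟱ final d
    where
    final : ∀ d → Runs n (if tl val then valᵣ := boolE false else valᵣ := boolE true)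
                    (state (nil ∙ d) (encᶜ _ ρ) w (unary n))
                    (state (encodeBool (isNil d)) (encᶜ _ ρ) w (unary n))
    final nil     = runs-else refl runs-:=
    final (_ ∙ _) = runs-then (λ ()) runs-:=
  correct (t ! u) ρ a w =
    correct t ρ a w ⨾⟱ runs-:= ⨾⟱ correct u ρ _ _ ⨾⟱
    runs-while (Fin.toℕ≤n (⟦ u ⟧ ρ)) (proj₂ (lookup-iterates (enc _ ∘ ⟦ t ⟧ ρ) (⟦ u ⟧ ρ) _ w)) ⨾⟱
    runs-:= ⨾⟱ runs-:=
  correct (table t) ρ a w =
    runs-:= ⨾⟱
    runs-while ≤-refl (proj₂ (table-iterates {t = t} (correct t) ρ n id (λ _ → refl) nil a w)) ⨾⟱
    runs-:= ⨾⟱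
    runs-≡ runs-:= (cong (λ v → state v _ _ _) (snocFin-nil _))
  correct (loop t u) ρ a w =
    correct t ρ a w ⨾⟱ runs-:= ⨾⟱
    runs-while ≤-refl (loop-iterates {u = u} (correct u) ρ n id (λ _ → refl) (⟦ t ⟧ ρ) w) ⨾⟱
    runs-:=

-- From terms to polynomial time decidability

countRows : Code
countRows = valᵣ := tl val ⨾ lenᵣ := cons nil len

program : Tm (arr (arr bit) ∷ []) bit → Program
program t = record
  { locals = 3
  ; body   = envᵣ := cons val nil ⨾ while val loop countRows ⨾ compile t
  }

countRows-iterates : ∀ m xs k ρ w →
  Iterates m val countRows (List.length xs)
    (state (encodeList xs) ρ w (unary k)) (state nil ρ w (unary (k + List.length xs)))
countRows-iterates m []       k ρ w =
  subst (λ j → Iterates m val countRows 0 (state nil ρ w (unary k)) (state nil ρ w (unary j)))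
        (sym (+-identityʳ k)) (done refl)
countRows-iterates m (x ∷ xs) k ρ w = again (λ ()) (runs-:= ⨾⟱ runs-:=)
  (subst (λ j → Iterates m val countRows (List.length xs)
                  (state (encodeList xs) ρ w (unary (suc k))) (state nil ρ w (unary j)))
         (sym (+-suc k (List.length xs))) (countRows-iterates m xs (suc k) ρ w))

program-runs : ∀ (t : Tm (arr (arr bit) ∷ []) bit) {m} (A : Fin m → Fin m → Bool) →
  Σ[ st ∈ Store 4 ] (Runs m (Program.body (program t)) (state (enc (arr (arr bit)) A) nil nil nil) st ×
                     lookup st zero ≡ encodeBool (⟦ t ⟧ (A , tt)))
program-runs t {m} A = _ ,
  (runs-:= ⨾⟱ runs-while (≤-reflexive m≡) iterates ⨾⟱ correct m t (A , tt) nil nil) , refl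
  where
  rows = List.tabulate (enc (arr bit) ∘ A)
  m≡ = length-tabulate (enc (arr bit) ∘ A)
  ρ = encᶜ (arr (arr bit) ∷ []) (A , tt)
  iterates : Iterates m val countRows (List.length rows)
               (state (encodeList rows) ρ nil (unary 0)) (state nil ρ nil (unary m))
  iterates = subst (λ j → Iterates m val countRows (List.length rows)
                            (state (encodeList rows) ρ nil (unary 0)) (state nil ρ nil (unary j)))
                   m≡ (countRows-iterates m rows 0 ρ nil)

encodeGraph≡ : ∀ G → encodeGraph G ≡ enc (arr (arr bit)) (Graph.adj G)
encodeGraph≡ G = cong encodeList (trans (map-tabulate id _)
  (tabulate-cong λ u → cong encodeList (map-tabulate id _)))

length<size : ∀ ts → List.length ts < size (encodeList ts)
length<size []       = s≤s z≤n
length<size (t ∷ ts) = s≤s (≤-trans (length<size ts) (m≤n+m _ (size t)))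

order<size : ∀ G → Graph.order G < size (encodeGraph G)
order<size G = subst₂ _<_ (length-tabulate (enc (arr bit) ∘ Graph.adj G)) (cong size (sym (encodeGraph≡ G)))
  (length<size (List.tabulate (enc (arr bit) ∘ Graph.adj G)))

-- Separates computation from mathematics: what remains is the value of a term. The bound of the
-- compiled program, taken at the order of the graph, is at most its value at the size of the
-- encoding, and a monomial majorises that.
decidable-by-term : ∀ {Class Property : Graph → Set} (t : Tm (arr (arr bit) ∷ []) bit) →
  (∀ G → Class G → Reflects (Property G) (⟦ t ⟧ (Graph.adj G , tt))) →
  PolynomialTimeDecidable Class Property
decidable-by-term {Class} {Property} t reflects = program t , c , d , decides
  where
  p = bound (Program.body (program t))
  c = proj₁ ⟦ p ⟧ᵖ-≤-monomial
  d = proj₁ (proj₂ ⟦ p ⟧ᵖ-≤-monomial)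

  halts : ∀ G → ∃[ time ] (HaltsWith (program t) (encodeGraph G) (encodeBool (⟦ t ⟧ (Graph.adj G , tt))) time ×
                           time ≤ ⟦ p ⟧ᵖ (Graph.order G))
  halts G with program-runs t (Graph.adj G)
  ... | st , runs {time} run time≤ , st₀≡ =
    time , (st , subst (λ x → ⟨ Program.body (program t) , state x nil nil nil ⟩⇓ st [ time ])
                       (sym (encodeGraph≡ G)) run , st₀≡) , time≤

  order≤ : ∀ G → ⟦ p ⟧ᵖ (Graph.order G) ≤ c * size (encodeGraph G) ^ d + c
  order≤ G = ≤-trans (⟦ p ⟧ᵖ-mono (<⇒≤ (order<size G)))
    (≤-trans (proj₂ (proj₂ ⟦ p ⟧ᵖ-≤-monomial) (size (encodeGraph G)) (≤-trans (s≤s z≤n) (order<size G)))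
             (m≤m+n _ c))

  decides : (G : Graph) → Class G → Σ[ answer ∈ Bool ] ∃[ time ]
    (HaltsWith (program t) (encodeGraph G) (encodeBool answer) time ×
     time ≤ c * size (encodeGraph G) ^ d + c × Reflects (Property G) answer)
  decides G G∈Class with halts G
  ... | time , halt , time≤ =
    ⟦ t ⟧ (Graph.adj G , tt) , time , halt , ≤-trans time≤ (order≤ G) , reflects G G∈Class

-- The decision procedure

infix 4 _==_

_==_ : ∀ {n} → Fin n → Fin n → Bool
i == j = toℕ i ≡ᵇ toℕ j

put : ∀ {n} {A : Set} → (Fin n → A) → Fin n → A → Fin n → A
put f i a j = when j == i then a else f j

every some : ∀ {n} → (Fin n → Bool) → Bool
every p = foldFin (λ i b → p i ∧ b) true
some p  = foldFin (λ i b → p i ∨ b) false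

Matrix : ℕ → Set
Matrix n = Fin n → Fin n → Bool

-- A degree modulo four, as its two binary digits.
increment : Bool × Bool → Bool × Bool
increment (h , l) = h xor l , not l

isThree isOdd : Bool × Bool → Bool
isThree (h , l) = h ∧ l
isOdd   (h , l) = l

degreeDigits : ∀ {n} → Matrix n → Fin n → Bool × Bool
degreeDigits A u = foldFin (λ v d → when A u v then increment d else d) (false , false)

module _ {n} (A : Matrix n) (d : Fin n → Bool × Bool) where

  oddGraph : Matrix n
  oddGraph u v = A u v ∧ (isOdd (d u) ∧ isOdd (d v))

  -- A vertex may stay unmatched if it does not have degree three, or if it can spend its minor arc
  -- on a neighbour of even degree, where no condition arises.
  fixable : Fin n → Bool
  fixable u = not (isThree (d u)) ∨ some (λ v → A u v ∧ not (isOdd (d v)))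

  -- The diagonal entries let an unmatched vertex count as matched with itself, so that a perfect
  -- matching can be asked for.
  mateGraph : Matrix n
  mateGraph u v = (A u v ∧ (isThree (d u) ∧ isThree (d v))) ∨ ((u == v) ∧ fixable u)

-- A class of vertices with the same label carries a colouring that is proper
-- on the edges seen so far; an edge between two classes merges them after
-- swapping, if necessary, the two colours of one of them.
Labelling : ℕ → Set
Labelling n = (Fin n → Fin n) × (Fin n → Bool)

merge : ∀ {n} → Fin n → Fin n → Labelling n → Labelling n
merge u v (l , c) =
  (λ w → when l w == l v then l u else l w) ,
  (λ w → when l w == l v then c w xor (c u xor not (c v)) else c w)

module _ {n} (H : Matrix n) where

  labelling : Labelling n
  labelling = foldFin (λ u x → foldFin (λ v y → when H u v then merge u v y else y) x)
                      ((λ v → v) , (λ _ → false))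

  isProper : (Fin n → Bool) → Bool
  isProper c = every λ u → every λ v → not (H u v ∧ not (c u xor c v))

-- The auction algorithm for perfect matchings.  Every column v has an owner
-- (absent if the flag is false) and a price; the last component of the state
-- is the row that is looking for a column.
Owners : ℕ → Set
Owners n = Fin n → Bool × Fin n

Auction : ℕ → Set
Auction n = (Owners n × (Fin n → ℕ)) × (Bool × Fin n)

module _ {n} (M : Matrix n) where

  -- The outer loop tries the prices from n - 1 down to 0, so the lowest one has the last word, and
  -- a column of price n is never found. The initial `u` is a dummy behind the flag `false`.
  cheapest : (Fin n → ℕ) → Fin n → Bool × Fin n
  cheapest p u = foldFin {n = n} (λ k x → foldFin (λ v y →
    when M u v ∧ (p v ≡ᵇ toℕ k) then (true , v) else y) x) (false , u)

  -- The previous owner `o v` becomes the seeking row; if there was none, its flag `false` says that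
  -- no row is seeking.
  award : Auction n → Bool × Fin n → Auction n
  award x@((o , p) , (_ , u)) (b , v) = when b
    then (put o v (true , u) , put p v (suc (p v))) , o v
    else x

  bid : Auction n → Auction n
  bid x@((o , p) , (b , u)) = when b then award x (cheapest p u) else x

  -- Each entering row is granted n * n bids. They suffice, since every bid raises the sum of the
  -- prices and no price exceeds n.
  auction : Owners n × (Fin n → ℕ)
  auction = foldFin (λ u x → proj₁ (foldFin {n = n} (λ _ y → foldFin {n = n} (λ _ → bid) y) (x , (true , u))))
                    ((λ v → false , v) , (λ _ → 0))

  isPerfect : Owners n → Bool
  isPerfect o = every λ u → some λ v → (proj₁ (o v) ∧ (proj₂ (o v) == u)) ∧ M u v

-- Both results are checked, so soundness rests on the checks alone. The two algorithms have to be
-- analysed only under the assumption that a proper colouring or a permutation exists.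
accepts : ∀ {n} → Matrix n → Bool
accepts A = isProper H (proj₂ (labelling H)) ∧ isPerfect M (proj₁ (auction M))
  where
  H = oddGraph A (degreeDigits A)
  M = mateGraph A (degreeDigits A)

-- The decision procedure as a term

v₀ : ∀ {Γ τ} → Tm (τ ∷ Γ) τ
v₀ = ` here

v₁ : ∀ {Γ τ ρ} → Tm (ρ ∷ τ ∷ Γ) τ
v₁ = ` (there here)

v₂ : ∀ {Γ τ ρ σ} → Tm (ρ ∷ σ ∷ τ ∷ Γ) τ
v₂ = ` (there (there here))

v₃ : ∀ {Γ τ ρ σ π} → Tm (ρ ∷ σ ∷ π ∷ τ ∷ Γ) τ
v₃ = ` (there (there (there here)))

v₄ : ∀ {Γ τ ρ σ π κ} → Tm (ρ ∷ σ ∷ π ∷ κ ∷ τ ∷ Γ) τ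
v₄ = ` (there (there (there (there here))))

v₆ : ∀ {Γ τ ρ σ π κ μ ν} → Tm (ρ ∷ σ ∷ π ∷ κ ∷ μ ∷ ν ∷ τ ∷ Γ) τ
v₆ = ` (there (there (there (there (there (there here))))))

negᵗ : ∀ {Γ} → Tm Γ bit → Tm Γ bit
negᵗ t = op (λ x _ → not x) t t

_==ᵗ_ : ∀ {Γ} → Tm Γ idx → Tm Γ idx → Tm Γ bit
t ==ᵗ u = equal (toNum t) u

-- Each loop binds its index as `v₀` and its accumulator as `v₁`; hence the next outer index is `v₂`
-- and the variable outside two nested loops is `v₄`.
everyᵗ someᵗ : ∀ {Γ} → Tm (idx ∷ bit ∷ Γ) bit → Tm Γ bit
everyᵗ t = loop (bool true) (op _∧_ t v₁)
someᵗ t  = loop (bool false) (op _∨_ t v₁)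

matrix : Ty
matrix = arr (arr bit)

incrementᵗ : Tm (bit ⊗ bit ∷ []) (bit ⊗ bit)
incrementᵗ = pair (op _xor_ (fst v₀) (snd v₀)) (negᵗ (snd v₀))

isThreeᵗ : ∀ {Γ} → Tm Γ (bit ⊗ bit) → Tm Γ bit
isThreeᵗ t = op _∧_ (fst t) (snd t)

degreeDigitsᵗ : Tm (matrix ∷ []) (arr (bit ⊗ bit))
degreeDigitsᵗ = table (loop (pair (bool false) (bool false))
  (cond (v₃ ! v₂ ! v₀) (call incrementᵗ v₁) v₁))

oddGraphᵗ : Tm (matrix ⊗ arr (bit ⊗ bit) ∷ []) matrix
oddGraphᵗ = table (table (op _∧_ (fst v₂ ! v₁ ! v₀)
  (op _∧_ (snd (snd v₂ ! v₁)) (snd (snd v₂ ! v₀)))))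

mateGraphᵗ : Tm (matrix ⊗ arr (bit ⊗ bit) ∷ []) matrix
mateGraphᵗ = table (table (op _∨_
  (op _∧_ (fst v₂ ! v₁ ! v₀) (op _∧_ (isThreeᵗ (snd v₂ ! v₁)) (isThreeᵗ (snd v₂ ! v₀))))
  (op _∧_ (v₁ ==ᵗ v₀)
    (op _∨_ (negᵗ (isThreeᵗ (snd v₂ ! v₁)))
            (someᵗ (op _∧_ (fst v₄ ! v₃ ! v₀) (negᵗ (snd (snd v₄ ! v₀)))))))))

labellingᵀ : Ty
labellingᵀ = arr idx ⊗ arr bit

mergeᵗ : Tm ((idx ⊗ idx) ⊗ labellingᵀ ∷ []) labellingᵀ
mergeᵗ = pair
  (table (cond ((l ! v₀) ==ᵗ (l ! v)) (l ! u) (l ! v₀)))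
  (table (cond ((l ! v₀) ==ᵗ (l ! v)) (op _xor_ (c ! v₀) (op _xor_ (c ! u) (negᵗ (c ! v)))) (c ! v₀)))
  where
  Γ = idx ∷ (idx ⊗ idx) ⊗ labellingᵀ ∷ []
  u v : Tm Γ idx
  u = fst (fst v₁)
  v = snd (fst v₁)
  l : Tm Γ (arr idx)
  l = fst (snd v₁)
  c : Tm Γ (arr bit)
  c = snd (snd v₁)

labellingᵗ : Tm (matrix ∷ []) labellingᵀ
labellingᵗ = loop (pair (table v₀) (table (bool false)))
  (loop v₁ (cond (v₄ ! v₂ ! v₀) (call mergeᵗ (pair (pair v₂ v₀) v₁)) v₁))

isProperᵗ : Tm (matrix ⊗ arr bit ∷ []) bit
isProperᵗ = everyᵗ (everyᵗ (negᵗ (op _∧_ (fst v₄ ! v₂ ! v₀)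
  (negᵗ (op _xor_ (snd v₄ ! v₂) (snd v₄ ! v₀))))))

ownersᵀ auctionᵀ : Ty
ownersᵀ  = arr (bit ⊗ idx)
auctionᵀ = (ownersᵀ ⊗ arr num) ⊗ (bit ⊗ idx)

cheapestᵗ : Tm (matrix ⊗ arr num ⊗ idx ∷ []) (bit ⊗ idx)
cheapestᵗ = loop (pair (bool false) (snd (snd v₀)))
  (loop v₁ (cond (op _∧_ (fst v₄ ! snd (snd v₄) ! v₀) (equal (fst (snd v₄) ! v₀) v₂))
                 (pair (bool true) v₀) v₁))

awardᵗ : Tm (auctionᵀ ⊗ (bit ⊗ idx) ∷ []) auctionᵀ
awardᵗ = cond (fst (snd v₀))
  (pair (pair (table (cond (v₀ ==ᵗ snd (snd v₁)) (pair (bool true) (snd (snd (fst v₁))))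
                           (fst (fst (fst v₁)) ! v₀)))
              (table (cond (v₀ ==ᵗ snd (snd v₁)) (sucᵗ (snd (fst (fst v₁)) ! snd (snd v₁)))
                           (snd (fst (fst v₁)) ! v₀))))
        (fst (fst (fst v₀)) ! snd (snd v₀)))
  (fst v₀)

bidᵗ : Tm (matrix ⊗ auctionᵀ ∷ []) auctionᵀ
bidᵗ = cond (fst (snd (snd v₀)))
  (call awardᵗ (pair (snd v₀)
    (call cheapestᵗ (pair (fst v₀) (pair (snd (fst (snd v₀))) (snd (snd (snd v₀))))))))
  (snd v₀)

auctionᵗ : Tm (matrix ∷ []) (ownersᵀ ⊗ arr num)
auctionᵗ = loop (pair (table (pair (bool false) v₀)) (table zeroᵗ))
  (fst (loop (pair v₁ (pair (bool true) v₀)) (loop v₁ (call bidᵗ (pair v₆ v₁)))))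

isPerfectᵗ : Tm (matrix ⊗ ownersᵀ ∷ []) bit
isPerfectᵗ = everyᵗ (someᵗ (op _∧_
  (op _∧_ (fst (snd v₄ ! v₀)) (snd (snd v₄ ! v₀) ==ᵗ v₂)) (fst v₄ ! v₂ ! v₀)))

acceptsᵗ : Tm (matrix ∷ []) bit
acceptsᵗ = op _∧_
  (bind (call oddGraphᵗ (pair v₀ (call degreeDigitsᵗ v₀)))
        (call isProperᵗ (pair v₀ (snd (call labellingᵗ v₀)))))
  (bind (call mateGraphᵗ (pair v₀ (call degreeDigitsᵗ v₀)))
        (call isPerfectᵗ (pair v₀ (fst (call auctionᵗ v₀)))))

-- The terms mirror the functions clause by clause, so both sides agree by computation.
acceptsᵗ≡ : ∀ {n} (A : Matrix n) → ⟦ acceptsᵗ ⟧ (A , tt) ≡ accepts A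
acceptsᵗ≡ A = refl

-- Correctness of the colouring and of the auction

T-not⁺ : ∀ {b} → ¬ T b → T (not b)
T-not⁺ {false} _  = tt
T-not⁺ {true}  ¬b = ¬b tt

T-not⁻ : ∀ {b} → T (not b) → ¬ T b
T-not⁻ {false} _ ()

==-refl : ∀ {n} (i : Fin n) → (i == i) ≡ true
==-refl i = to T-≡ (≡⇒≡ᵇ (toℕ i) (toℕ i) refl)

==⇒≡ : ∀ {n} {i j : Fin n} → T (i == j) → i ≡ j
==⇒≡ i==j = Fin.toℕ-injective (≡ᵇ⇒≡ _ _ i==j)

≢⇒== : ∀ {n} {i j : Fin n} → i ≢ j → (i == j) ≡ false
≢⇒== {i = i} {j} i≢j with i == j in eq
... | false = refl
... | true  = ⊥-elim (i≢j (==⇒≡ (from T-≡ eq)))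

put-≡ : ∀ {n} {A : Set} (f : Fin n → A) i {a} → put f i a i ≡ a
put-≡ f i rewrite ==-refl i = refl

put-≢ : ∀ {n} {A : Set} (f : Fin n → A) {i j a} → j ≢ i → put f i a j ≡ f j
put-≢ f j≢i rewrite ≢⇒== j≢i = refl

-- foldFin visits the indices in decreasing order, so P k speaks about the
-- moment when exactly the indices from k on have been visited.
foldFin-induction : ∀ {A : Set} (P : ℕ → A → Set) {n} (f : Fin n → A → A) {a} →
  (∀ i a → P (suc (toℕ i)) a → P (toℕ i) (f i a)) → P n a → P 0 (foldFin f a)
foldFin-induction P {zero}  f step base = base
foldFin-induction P {suc n} f step base =
  step zero _ (foldFin-induction (P ∘ suc) (f ∘ suc) (λ i a → step (suc i) a) base)

-- `J` is an invariant of the accumulator, while `Q i` is achieved in the step of `i` and destroyed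
-- by no other step.
foldFin-∀ : ∀ {A : Set} (J : A → Set) {n} (Q : Fin n → A → Set) (f : Fin n → A → A) {a} →
  (∀ i a → J a → J (f i a) × Q i (f i a) × (∀ j → Q j a → Q j (f i a))) →
  J a → J (foldFin f a) × (∀ i → Q i (foldFin f a))
foldFin-∀ J {zero}  Q f step base = base , λ ()
foldFin-∀ J {suc n} Q f step base
  with foldFin-∀ J (Q ∘ suc) (f ∘ suc)
         (λ i a Ja → let J′ , Q′ , stable = step (suc i) a Ja in J′ , Q′ , λ j → stable (suc j)) base
... | J′ , Q′ with step zero _ J′
... | J″ , Q₀ , stable = J″ , λ { zero → Q₀ ; (suc i) → stable (suc i) (Q′ i) }

foldFin-repeat : ∀ {A : Set} (P : ℕ → A → Set) {f : A → A} → (∀ {k a} → P k a → P (suc k) (f a)) →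
  ∀ n {k a} → P k a → P (n + k) (foldFin {n = n} (λ _ → f) a)
foldFin-repeat P step zero    base = base
foldFin-repeat P step (suc n) base = step (foldFin-repeat P step n base)

foldFin-search : ∀ {n} {I : Set} (q : Fin n → Bool) (g : Fin n → I) (x : Bool × I) →
  let y = foldFin (λ v y → when q v then (true , g v) else y) x in
  (∃[ v ] (y ≡ (true , g v) × T (q v))) ⊎ (y ≡ x × (∀ v → ¬ T (q v)))
foldFin-search {zero}  q g x = inj₂ (refl , λ ())
foldFin-search {suc n} q g x with q zero in eq
... | true  = inj₁ (zero , refl , from T-≡ eq)
... | false with foldFin-search (q ∘ suc) (g ∘ suc) x
...   | inj₁ (v , y≡ , qv) = inj₁ (suc v , y≡ , qv)
...   | inj₂ (y≡ , ¬q)     = inj₂ (y≡ , λ { zero → subst T eq ; (suc v) → ¬q v })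

every⁻ : ∀ {n} (p : Fin n → Bool) → T (every p) → ∀ i → T (p i)
every⁻ {suc n} p all zero    = proj₁ (to T-∧ all)
every⁻ {suc n} p all (suc i) = every⁻ (p ∘ suc) (proj₂ (to (T-∧ {p zero}) all)) i

every⁺ : ∀ {n} (p : Fin n → Bool) → (∀ i → T (p i)) → T (every p)
every⁺ {zero}  p all = tt
every⁺ {suc n} p all = from T-∧ (all zero , every⁺ (p ∘ suc) (all ∘ suc))

some⁻ : ∀ {n} (p : Fin n → Bool) → T (some p) → ∃[ i ] T (p i)
some⁻ {suc n} p any with to (T-∨ {p zero}) any
... | inj₁ p₀   = zero , p₀
... | inj₂ any′ = let i , pᵢ = some⁻ (p ∘ suc) any′ in suc i , pᵢ

some⁺ : ∀ {n} (p : Fin n → Bool) i → T (p i) → T (some p)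
some⁺ p zero    pᵢ = from T-∨ (inj₁ pᵢ)
some⁺ p (suc i) pᵢ = from (T-∨ {p zero}) (inj₂ (some⁺ (p ∘ suc) i pᵢ))

-- Merging labels yields a proper colouring if there is one

ProperColouring : ∀ {n} → Matrix n → (Fin n → Bool) → Set
ProperColouring H s = ∀ u v → T (H u v) → s u ≢ s v

isProper⁻ : ∀ {n} (H : Matrix n) c → T (isProper H c) → ProperColouring H c
isProper⁻ H c ok u v Huv cu≡cv with every⁻ _ (every⁻ _ ok u) v
... | t rewrite to T-≡ Huv | cu≡cv with c v | t
... | true  | ()
... | false | ()

isProper⁺ : ∀ {n} (H : Matrix n) c → ProperColouring H c → T (isProper H c)
isProper⁺ H c proper = every⁺ _ λ u → every⁺ _ λ v → edge u v
  where
  edge : ∀ u v → T (not (H u v ∧ not (c u xor c v)))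
  edge u v with H u v in Huv | c u in cu | c v in cv
  ... | false | _     | _     = tt
  ... | true  | true  | false = tt
  ... | true  | false | true  = tt
  ... | true  | true  | true  = proper u v (from T-≡ Huv) (trans cu (sym cv))
  ... | true  | false | false = proper u v (from T-≡ Huv) (trans cu (sym cv))

Coarser : ∀ {n} → Labelling n → Labelling n → Set
Coarser (l , _) (l′ , _) = ∀ x y → l x ≡ l y → l′ x ≡ l′ y

merge-coarser : ∀ {n} u v (x : Labelling n) → Coarser x (merge u v x)
merge-coarser u v (l , c) x y = cong (λ z → when z == l v then l u else z)

merge-joins : ∀ {n} u v (x : Labelling n) → let l = proj₁ (merge u v x) in l u ≡ l v
merge-joins u v (l , c) rewrite ==-refl (l v) with l u == l v
... | true  = refl
... | false = refl

swap≡ : ∀ b a c → a xor not c ≡ (not b xor a) xor (b xor c)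
swap≡ false false c     = refl
swap≡ false true  true  = refl
swap≡ false true  false = refl
swap≡ true  false c     = refl
swap≡ true  true  c     = refl

xor-cancel : ∀ a b → b xor (a xor b) ≡ a
xor-cancel false false = refl
xor-cancel false true  = refl
xor-cancel true  false = refl
xor-cancel true  true  = refl

module _ {n} (H : Matrix n) (s : Fin n → Bool) (s-proper : ProperColouring H s) where

  -- On each class `c` agrees with the given colouring `s` up to one swap, which is the constant
  -- value of `s xor c` there.
  Faithful : Labelling n → Set
  Faithful (l , c) = ∀ x y → l x ≡ l y → s x xor c x ≡ s y xor c y

  -- The swap bit `c u xor not (c v)` is set if the two ends have equal colours. As `s u` and `s v`
  -- differ, it carries the constant of the class of `v` to that of the class of `u`.
  merge-faithful : ∀ u v x → T (H u v) → Faithful x → Faithful (merge u v x)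
  merge-faithful u v (l , c) Huv faithful = preserved
    where
    shift : ∀ x → l x ≡ l v → s x xor (c x xor (c u xor not (c v))) ≡ s u xor c u
    shift x lx≡lv = begin
      s x xor (c x xor (c u xor not (c v)))             ≡⟨ xor-assoc (s x) (c x) _ ⟨
      (s x xor c x) xor (c u xor not (c v))
        ≡⟨ cong₂ _xor_ (faithful x v lx≡lv) (swap≡ (s v) (c u) (c v)) ⟩
      (s v xor c v) xor ((not (s v) xor c u) xor (s v xor c v))
        ≡⟨ xor-cancel (not (s v) xor c u) (s v xor c v) ⟩
      not (s v) xor c u                                 ≡⟨ cong (_xor c u) (¬-not (s-proper u v Huv)) ⟨
      s u xor c u                                       ∎
      where open ≡-Reasoning

    preserved : Faithful (merge u v (l , c))
    preserved x y l′≡ with l x == l v in eqx | l y == l v in eqy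
    ... | false | false = faithful x y l′≡
    ... | true  | true  = shifted
      where
      shifted : s x xor (c x xor (c u xor not (c v))) ≡ s y xor (c y xor (c u xor not (c v)))
      shifted rewrite sym (xor-assoc (s x) (c x) (c u xor not (c v)))
                    | sym (xor-assoc (s y) (c y) (c u xor not (c v)))
        = cong (_xor (c u xor not (c v)))
            (faithful x y (trans (==⇒≡ (from T-≡ eqx)) (sym (==⇒≡ (from T-≡ eqy)))))
    ... | true  | false = trans (shift x (==⇒≡ (from T-≡ eqx))) (faithful u y l′≡)
    ... | false | true  = trans (faithful x u l′≡) (sym (shift y (==⇒≡ (from T-≡ eqy))))
  SameLabel : Fin n → Fin n → Labelling n → Set
  SameLabel u v (l , _) = T (H u v) → l u ≡ l v

  scanRow : Fin n → Labelling n → Labelling n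
  scanRow u = foldFin (λ v y → when H u v then merge u v y else y)

  scanRow-correct : ∀ u x → Faithful x →
    (Faithful (scanRow u x) × Coarser x (scanRow u x)) × (∀ v → SameLabel u v (scanRow u x))
  scanRow-correct u x faithful =
    foldFin-∀ (λ y → Faithful y × Coarser x y) (SameLabel u) _ step (faithful , λ _ _ → id)
    where
    step : ∀ v y → Faithful y × Coarser x y →
      let y′ = when H u v then merge u v y else y in
      (Faithful y′ × Coarser x y′) × SameLabel u v y′ × (∀ w → SameLabel u w y → SameLabel u w y′)
    step v y (f , cs) with H u v in Huv
    ... | false = (f , cs) , (λ ()) , (λ _ → id)
    ... | true  =
      (merge-faithful u v y (from T-≡ Huv) f , (λ a b → merge-coarser u v y a b ∘ cs a b)) ,
      (λ _ → merge-joins u v y) , (λ w same → merge-coarser u v y u w ∘ same)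

  -- In the end adjacent vertices share a label, so by faithfulness `c` distinguishes them because
  -- `s` does.
  labelling-proper : ProperColouring H (proj₂ (labelling H))
  labelling-proper u v Huv cu≡cv = s-proper u v Huv (xor-cancelʳ (s u) (s v) eq)
    where
    result : Faithful (labelling H) × (∀ u v → SameLabel u v (labelling H))
    result = foldFin-∀ Faithful (λ u y → ∀ v → SameLabel u v y) scanRow
      (λ u x f → let (f′ , cs) , same = scanRow-correct u x f in
        f′ , same , λ w same′ v → cs w v ∘ same′ v)
      (λ { x .x refl → refl })
    c = proj₂ (labelling H)
    eq : s u xor c v ≡ s v xor c v
    eq = subst (λ b → s u xor b ≡ s v xor c v) cu≡cv (proj₁ result u v (proj₂ result u v Huv))
    xor-cancelʳ : ∀ a b {c} → a xor c ≡ b xor c → a ≡ b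
    xor-cancelʳ false false _ = refl
    xor-cancelʳ true  true  _ = refl
    xor-cancelʳ false true  {true}  ()
    xor-cancelʳ false true  {false} ()
    xor-cancelʳ true  false {true}  ()
    xor-cancelʳ true  false {false} ()

-- The auction finds a perfect matching if there is one

sumFin : ∀ {n} → (Fin n → ℕ) → ℕ
sumFin p = foldFin (λ i a → p i + a) 0

sumFin-put : ∀ {n} (p : Fin n → ℕ) v → sumFin (put p v (suc (p v))) ≡ suc (sumFin p)
sumFin-put p zero    = refl
sumFin-put p (suc v) = trans (cong (λ k → p zero + k) (sumFin-put (p ∘ suc) v)) (+-suc (p zero) _)

sumFin-≤ : ∀ {n} (p : Fin n → ℕ) {b} → (∀ v → p v ≤ b) → sumFin p ≤ n * b
sumFin-≤ {zero}  p p≤ = z≤n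
sumFin-≤ {suc n} p p≤ = +-mono-≤ (p≤ zero) (sumFin-≤ (p ∘ suc) (p≤ ∘ suc))

sumFin-< : ∀ {n} (p : Fin n → ℕ) {b} → (∀ v → p v ≤ b) → ∀ v → p v < b → sumFin p < n * b
sumFin-< p p≤ zero    p<b = +-mono-<-≤ p<b (sumFin-≤ (p ∘ suc) (p≤ ∘ suc))
sumFin-< p p≤ (suc v) p<b = +-mono-≤-< (p≤ zero) (sumFin-< (p ∘ suc) (p≤ ∘ suc) v p<b)

Covers : ∀ {n} → Matrix n → Owners n → Set
Covers M o = ∀ u → ∃[ v ] (o v ≡ (true , u) × T (M u v))

isPerfect⁻ : ∀ {n} (M : Matrix n) o → T (isPerfect M o) → Covers M o
isPerfect⁻ M o ok u with some⁻ _ (every⁻ _ ok u)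
... | v , t with to (T-∧ {proj₁ (o v) ∧ (proj₂ (o v) == u)}) t
... | t′ , Muv with to (T-∧ {proj₁ (o v)}) t′
... | owned , owner = v , cong₂ _,_ (to T-≡ owned) (==⇒≡ owner) , Muv

isPerfect⁺ : ∀ {n} (M : Matrix n) o → Covers M o → T (isPerfect M o)
isPerfect⁺ M o covers = every⁺ _ λ u → let v , o≡ , Muv = covers u in
  some⁺ _ v (from T-∧ (from T-∧ (from T-≡ (cong proj₁ o≡) ,
    from T-≡ (trans (cong (λ z → proj₂ z == u) o≡) (==-refl u))) , Muv))

module _ {n} (M : Matrix n) where

  -- `tight` is the approximate complementary slackness of auction algorithms with increment one: an
  -- owner holds a column at most one unit dearer than its cheapest choice.
  record Valid (o : Owners n) (p : Fin n → ℕ) : Set where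
    field
      edge     : ∀ {v u} → o v ≡ (true , u) → T (M u v)
      tight    : ∀ {v u} w → o v ≡ (true , u) → T (M u w) → p v ≤ suc (p w)
      unowned  : ∀ {v} → proj₁ (o v) ≡ false → p v ≡ 0
      distinct : ∀ {v w u} → o v ≡ (true , u) → o w ≡ (true , u) → v ≡ w
      bounded  : ∀ v → p v ≤ n

  -- K is the set of rows that have entered the auction so far.
  record Good (K : Fin n → Set) (x : Auction n) : Set where
    o = proj₁ (proj₁ x)
    p = proj₂ (proj₁ x)
    field
      valid   : Valid o p
      idle    : ∀ {u} → proj₂ x ≡ (true , u) → ∀ v → o v ≢ (true , u)
      known   : ∀ {v u} → o v ≡ (true , u) → K u
      seeking : ∀ {u} → proj₂ x ≡ (true , u) → K u
      present : ∀ {u} → K u → (∃[ v ] o v ≡ (true , u)) ⊎ proj₂ x ≡ (true , u)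

  record Cheapest (p : Fin n → ℕ) (u v : Fin n) : Set where
    field
      edge    : T (M u v)
      below   : p v < n
      minimal : ∀ w → T (M u w) → p v ≤ p w

  cheapest-correct : ∀ p u →
    (∃[ v ] (cheapest M p u ≡ (true , v) × Cheapest p u v)) ⊎ (∀ v → T (M u v) → n ≤ p v)
  cheapest-correct p u with foldFin-induction P level step base
    where
    Found : ℕ → Bool × Fin n → Set
    Found k y = ∃[ v ] (y ≡ (true , v) × T (M u v) × p v < n × (∀ w → T (M u w) → k ≤ p w → p v ≤ p w))
    P : ℕ → Bool × Fin n → Set
    P k y = Found k y ⊎ (∀ w → T (M u w) → k ≤ p w → n ≤ p w)
    level : Fin n → Bool × Fin n → Bool × Fin n
    level k = foldFin (λ v y → when M u v ∧ (p v ≡ᵇ toℕ k) then (true , v) else y)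
    base : P n (false , u)
    base = inj₂ λ _ _ → id
    step : ∀ k y → P (suc (toℕ k)) y → P (toℕ k) (level k y)
    step k y ih with foldFin-search (λ v → M u v ∧ (p v ≡ᵇ toℕ k)) id y
    ... | inj₁ (v , y≡ , q) = let Muv , pv≡ = to (T-∧ {M u v}) q
                                  pv≡k = ≡ᵇ⇒≡ (p v) (toℕ k) pv≡ in
      inj₁ (v , y≡ , Muv , subst (_< n) (sym pv≡k) (Fin.toℕ<n k) ,
            λ w _ k≤ → subst (_≤ p w) (sym pv≡k) k≤)
    ... | inj₂ (y≡ , none) rewrite y≡ = weaken ih
      where
      above : ∀ w → T (M u w) → toℕ k ≤ p w → toℕ k < p w
      above w Muw k≤ = ≤∧≢⇒< k≤ λ k≡ → none w (from T-∧ (Muw , ≡⇒≡ᵇ (p w) (toℕ k) (sym k≡)))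
      weaken : P (suc (toℕ k)) y → P (toℕ k) y
      weaken (inj₁ (v , y≡ , Muv , < , min)) = inj₁ (v , y≡ , Muv , < , λ w Muw k≤ → min w Muw (above w Muw k≤))
      weaken (inj₂ none≤) = inj₂ λ w Muw k≤ → none≤ w Muw (above w Muw k≤)
  ... | inj₁ (v , y≡ , Muv , < , min) =
    inj₁ (v , y≡ , record { edge = Muv ; below = < ; minimal = λ w Muw → min w Muw z≤n })
  ... | inj₂ none = inj₂ λ v Muv → none v Muv z≤n

  -- Prices only rise, which preserves `tight` for the other owners, and the winner pays one unit
  -- more than the minimum. By `distinct` the displaced row held no second column, so it is idle.
  award-good : ∀ {K o p u v} → Good K ((o , p) , (true , u)) → Cheapest p u v →
               Good K (award M ((o , p) , (true , u)) (true , v))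
  award-good {K} {o} {p} {u} {v} good ch = record
    { valid = record
      { edge     = edge′
      ; tight    = tight′
      ; unowned  = unowned′
      ; distinct = distinct′
      ; bounded  = bounded′
      }
    ; idle    = idle′
    ; known   = known′
    ; seeking = G.known
    ; present = present′ ∘ G.present
    }
    where
    module G = Good good
    module V = Valid G.valid
    module C = Cheapest ch
    o′ = put o v (true , u)
    p′ = put p v (suc (p v))

    owner : ∀ {w x} → o′ w ≡ (true , x) → (w ≡ v × x ≡ u) ⊎ (w ≢ v × o w ≡ (true , x))
    owner {w} eq with w Fin.≟ v
    ... | yes refl = inj₁ (refl , cong proj₂ (trans (sym eq) (put-≡ o v)))
    ... | no w≢v   = inj₂ (w≢v , trans (sym (put-≢ o w≢v)) eq)

    p≤p′ : ∀ w → p w ≤ p′ w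
    p≤p′ w with w Fin.≟ v
    ... | yes refl = subst (p v ≤_) (sym (put-≡ p v)) (n≤1+n (p v))
    ... | no w≢v   = ≤-reflexive (sym (put-≢ p w≢v))

    edge′ : ∀ {w x} → o′ w ≡ (true , x) → T (M x w)
    edge′ eq with owner eq
    ... | inj₁ (refl , refl) = C.edge
    ... | inj₂ (_ , o≡)      = V.edge o≡

    tight′ : ∀ {w x} y → o′ w ≡ (true , x) → T (M x y) → p′ w ≤ suc (p′ y)
    tight′ y eq Mxy with owner eq
    ... | inj₁ (refl , refl) = subst (_≤ suc (p′ y)) (sym (put-≡ p v)) (s≤s (≤-trans (C.minimal y Mxy) (p≤p′ y)))
    ... | inj₂ (w≢v , o≡)    = subst (_≤ suc (p′ y)) (sym (put-≢ p w≢v)) (≤-trans (V.tight y o≡ Mxy) (s≤s (p≤p′ y)))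

    unowned′ : ∀ {w} → proj₁ (o′ w) ≡ false → p′ w ≡ 0
    unowned′ {w} eq with w Fin.≟ v
    ... | yes refl with trans (sym eq) (cong proj₁ (put-≡ o v))
    ...   | ()
    unowned′ {w} eq | no w≢v =
      trans (put-≢ p w≢v) (V.unowned (trans (cong proj₁ (sym (put-≢ o w≢v))) eq))

    distinct′ : ∀ {w y x} → o′ w ≡ (true , x) → o′ y ≡ (true , x) → w ≡ y
    distinct′ eq eq′ with owner eq | owner eq′
    ... | inj₁ (w≡ , _)    | inj₁ (y≡ , _)    = trans w≡ (sym y≡)
    ... | inj₁ (_ , refl)  | inj₂ (_ , o≡)    = ⊥-elim (G.idle refl _ o≡)
    ... | inj₂ (_ , o≡)    | inj₁ (_ , refl)  = ⊥-elim (G.idle refl _ o≡)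
    ... | inj₂ (_ , o≡)    | inj₂ (_ , o≡′)   = V.distinct o≡ o≡′

    bounded′ : ∀ w → p′ w ≤ n
    bounded′ w with w Fin.≟ v
    ... | yes refl = subst (_≤ n) (sym (put-≡ p v)) C.below
    ... | no w≢v   = subst (_≤ n) (sym (put-≢ p w≢v)) (V.bounded w)

    idle′ : ∀ {x} → o v ≡ (true , x) → ∀ w → o′ w ≢ (true , x)
    idle′ ov≡ w eq with owner eq
    ... | inj₁ (_ , refl)   = G.idle refl v ov≡
    ... | inj₂ (w≢v , ow≡)  = w≢v (V.distinct ow≡ ov≡)

    known′ : ∀ {w x} → o′ w ≡ (true , x) → K x
    known′ eq with owner eq
    ... | inj₁ (_ , refl) = G.seeking refl
    ... | inj₂ (_ , o≡)   = G.known o≡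

    present′ : ∀ {x} → (∃[ w ] o w ≡ (true , x)) ⊎ (true , u) ≡ (true , x) →
               (∃[ w ] o′ w ≡ (true , x)) ⊎ o v ≡ (true , x)
    present′ (inj₂ refl) = inj₁ (v , put-≡ o v)
    present′ (inj₁ (w , o≡)) with w Fin.≟ v
    ... | yes refl = inj₂ o≡
    ... | no w≢v   = inj₁ (w , trans (put-≢ o w≢v) o≡)

  module _ (f : Fin n → Fin n) (f-injective : Injective _≡_ _≡_ f) (f-edge : ∀ u → T (M u (f u))) where

    -- Alternate between f and the owners, starting from an idle row: if all
    -- columns of that row had price n, the walk would lose at most one unit of
    -- price per step and so visit n + 1 different rows.
    not-priced-out : ∀ {K o p u} → Good K ((o , p) , (true , u)) → ¬ (∀ v → T (M u v) → n ≤ p v)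
    not-priced-out {K} {o} {p} {u} good dear =
      let i , j , i<j , eq = Fin.pigeonhole (n<1+n n) (walk ∘ toℕ)
      in walk-distinct i<j (≤-pred (Fin.toℕ<n j)) eq
      where
      open Good good using (valid; idle)
      open Valid valid
      walk : ℕ → Fin n
      walk zero    = u
      walk (suc i) = proj₂ (o (f (walk i)))

      owned-if-priced : ∀ v → 0 < p v → o v ≡ (true , proj₂ (o v))
      owned-if-priced v 0<p with proj₁ (o v) in eq
      ... | true  = cong (_, proj₂ (o v)) eq
      ... | false = ⊥-elim (n≮0 (subst (0 <_) (unowned eq) 0<p))

      priced : ∀ i → i ≤ n → n ≤ i + p (f (walk i))
      owned : ∀ i → i < n → o (f (walk i)) ≡ (true , walk (suc i))

      priced zero    _   = dear (f u) (f-edge u)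
      priced (suc i) i<n = begin
        n                                ≤⟨ priced i (<⇒≤ i<n) ⟩
        i + p (f (walk i))               ≤⟨ +-monoʳ-≤ i (tight _ (owned i i<n) (f-edge (walk (suc i)))) ⟩
        i + suc (p (f (walk (suc i))))   ≡⟨ +-suc i _ ⟩
        suc i + p (f (walk (suc i)))     ∎
        where open ≤-Reasoning

      owned i i<n = owned-if-priced _ (+-cancelˡ-< i 0 _
        (subst (_< i + p (f (walk i))) (sym (+-identityʳ i)) (≤-trans i<n (priced i (<⇒≤ i<n)))))

      -- A repetition can be pulled back: equal owners hold the same column, which by injectivity of
      -- `f` comes from the same earlier row. This ends at the starting row, which would own a
      -- column although it is idle.
      walk-distinct : ∀ {i j} → i < j → j ≤ n → walk i ≢ walk j
      walk-distinct {zero}  {suc j} _         j<n eq =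
        idle refl (f (walk j)) (trans (owned j j<n) (cong (true ,_) (sym eq)))
      walk-distinct {suc i} {suc j} (s≤s i<j) j<n eq = walk-distinct i<j (<⇒≤ j<n)
        (f-injective (distinct (trans (owned i (<-trans i<j j<n)) (cong (true ,_) eq)) (owned j j<n)))

    -- Measures progress: if a row is still seeking after k bids, each of them has raised the sum of
    -- the prices by one.
    Busy : (Fin n → Set) → ℕ → Auction n → Set
    Busy K k x = Good K x × (T (proj₁ (proj₂ x)) → k ≤ sumFin (proj₂ (proj₁ x)))

    bid-busy : ∀ {K k} x → Busy K k x → Busy K (suc k) (bid M x)
    bid-busy ((o , p) , (false , u)) (good , _) = good , λ ()
    bid-busy {K} {k} ((o , p) , (true , u)) (good , k≤) with cheapest-correct p u
    ... | inj₂ dear = ⊥-elim (not-priced-out good dear)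
    ... | inj₁ (v , eq , ch) rewrite eq =
      award-good good ch , λ _ → subst (suc k ≤_) (sym (sumFin-put p v)) (s≤s (k≤ tt))

    auctionRow : Fin n → Owners n × (Fin n → ℕ) → Auction n
    auctionRow u x = foldFin {n = n} (λ _ y → foldFin {n = n} (λ _ → bid M) y) (x , (true , u))

    -- A row still seeking after n * n bids would make the sum of the prices at least n * n; but
    -- some column is still below n and none is above n.
    auctionRow-good : ∀ {K} u x → Good K (x , (true , u)) →
      Good K (auctionRow u x) × proj₁ (proj₂ (auctionRow u x)) ≡ false
    auctionRow-good {K} u x good
      with auctionRow u x
         -- `suc j * n` computes to `n + j * n`, the count after n further bids.
         | foldFin-repeat (λ j → Busy K (j * n)) {foldFin {n = n} (λ _ → bid M)}
             (λ {j} → foldFin-repeat (Busy K) {bid M} (λ {k} {y} → bid-busy y) n) n {0} (good , λ _ → z≤n)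
    ... | y , (false , _) | good′ , _ = good′ , refl
    ... | (o , p) , (true , w) | good′ , total≤ with cheapest-correct p w
    ...   | inj₂ dear = ⊥-elim (not-priced-out good′ dear)
    ...   | inj₁ (v , _ , ch) = ⊥-elim (<⇒≱
      (sumFin-< p (Valid.bounded (Good.valid good′)) v (Cheapest.below ch))
      (subst (λ m → m * n ≤ sumFin p) (+-identityʳ n) (total≤ tt)))

    auction-covers : Covers M (proj₁ (auction M))
    auction-covers = covers (foldFin-induction P (λ u x → proj₁ (auctionRow u x)) step base)
      where
      K : ℕ → Fin n → Set
      K k u = k ≤ toℕ u
      P : ℕ → Owners n × (Fin n → ℕ) → Set
      P k (o , p) = Valid o p × (∀ {v u} → o v ≡ (true , u) → K k u) × (∀ u → K k u → ∃[ v ] o v ≡ (true , u))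
      covers : P 0 (auction M) → Covers M (proj₁ (auction M))
      covers (valid , _ , all) u = let v , o≡ = all u z≤n in v , o≡ , Valid.edge valid o≡
      base : P n ((λ v → false , v) , (λ _ → 0))
      base = record { edge = λ () ; tight = λ _ () ; unowned = λ _ → refl ; distinct = λ () ; bounded = λ _ → z≤n } ,
             (λ ()) , (λ u n≤u → ⊥-elim (<⇒≱ (Fin.toℕ<n u) n≤u))
      step : ∀ u x → P (suc (toℕ u)) x → P (toℕ u) (proj₁ (auctionRow u x))
      step u x@(o , p) (valid , known , all)
        with auctionRow u x | auctionRow-good {K (toℕ u)} u x (record
          { valid   = valid
          ; idle    = λ { refl v o≡ → 1+n≰n (known o≡) }
          ; known   = <⇒≤ ∘ known
          ; seeking = λ { refl → ≤-refl }
          ; present = present _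
          })
        where
        present : ∀ w → toℕ u ≤ toℕ w → (∃[ v ] o v ≡ (true , w)) ⊎ (true , u) ≡ (true , w)
        present w u≤w with m≤n⇒m<n∨m≡n u≤w
        ... | inj₁ u<w = inj₁ (all w u<w)
        ... | inj₂ u≡w = inj₂ (cong (true ,_) (Fin.toℕ-injective u≡w))
      ... | y , (.false , _) | good , refl = Good.valid good , Good.known good ,
        λ w Kw → [ id , (λ ()) ]′ (Good.present good Kw)

-- From orientations to colourings and matchings

count-cong : ∀ {n} {p q : Fin n → Bool} → (∀ i → p i ≡ q i) → count p ≡ count q
count-cong p≗q = cong ∣_∣ (Vec.tabulate-cong p≗q)

count-add : ∀ {n} (p q r : Fin n → Bool) → (∀ i → p i ≡ q i ∨ r i) → (∀ i → T (q i) → ¬ T (r i)) →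
            count p ≡ count q + count r
count-add {zero}  p q r p≡ disj = refl
count-add {suc n} p q r p≡ disj
  with p zero | q zero | r zero | p≡ zero | disj zero
     | count-add (p ∘ suc) (q ∘ suc) (r ∘ suc) (p≡ ∘ suc) (disj ∘ suc)
... | .true  | true  | true  | refl | ¬r | ih = ⊥-elim (¬r tt tt)
... | .true  | true  | false | refl | _  | ih = cong suc ih
... | .true  | false | true  | refl | _  | ih = trans (cong suc ih) (sym (+-suc (count (q ∘ suc)) _))
... | .false | false | false | refl | _  | ih = ih

count-insert : ∀ {n} (p q : Fin n → Bool) i → p i ≡ false → q i ≡ true →
               (∀ j → j ≢ i → q j ≡ p j) → count q ≡ suc (count p)
count-insert p q zero p₀ q₀ q≗p rewrite p₀ | q₀ = cong suc (count-cong λ j → q≗p (suc j) λ ())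
count-insert p q (suc i) pᵢ qᵢ q≗p
  with p zero | q zero | q≗p zero (λ ())
     | count-insert (p ∘ suc) (q ∘ suc) i pᵢ qᵢ (λ j j≢i → q≗p (suc j) (j≢i ∘ Fin.suc-injective))
... | true  | .true  | refl | ih = cong suc ih
... | false | .false | refl | ih = ih

count-none : ∀ {n} (p : Fin n → Bool) → (∀ i → ¬ T (p i)) → count p ≡ 0
count-none {zero}  p none = refl
count-none {suc n} p none with p zero | none zero
... | true  | ¬p = ⊥-elim (¬p tt)
... | false | _  = count-none (p ∘ suc) (none ∘ suc)

count-single : ∀ {n} (p : Fin n → Bool) i → T (p i) → (∀ j → T (p j) → j ≡ i) → count p ≡ 1
count-single {n} p i pᵢ unique = trans (count-insert (λ _ → false) p i refl (to T-≡ pᵢ) others)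
                                   (cong suc (count-none {n} (λ _ → false) λ _ → id))
  where
  others : ∀ j → j ≢ i → p j ≡ false
  others j j≢i with p j in pj
  ... | false = refl
  ... | true  = ⊥-elim (j≢i (unique j (from T-≡ pj)))

count-positive : ∀ {n} (p : Fin n → Bool) i → T (p i) → 0 < count p
count-positive p zero    pᵢ rewrite to T-≡ pᵢ = z<s
count-positive p (suc i) pᵢ with p zero
... | true  = z<s
... | false = count-positive (p ∘ suc) i pᵢ

count-witness : ∀ {n} (p : Fin n → Bool) → 0 < count p → ∃[ i ] T (p i)
count-witness p 0< with Fin.any? (λ i → T? (p i))
... | yes found = found
... | no ¬found = ⊥-elim (n≮0 (subst (0 <_) (count-none p λ i pᵢ → ¬found (i , pᵢ)) 0<))

count-unique : ∀ {n} (p : Fin n → Bool) → count p ≡ 1 → ∀ {i j} → T (p i) → T (p j) → i ≡ j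
count-unique p ≡1 {zero}  {zero}  pᵢ pⱼ = refl
count-unique p ≡1 {zero}  {suc j} pᵢ pⱼ rewrite to T-≡ pᵢ =
  ⊥-elim (<⇒≢ (count-positive (p ∘ suc) j pⱼ) (sym (suc-injective ≡1)))
count-unique p ≡1 {suc i} {zero}  pᵢ pⱼ rewrite to T-≡ pⱼ =
  ⊥-elim (<⇒≢ (count-positive (p ∘ suc) i pᵢ) (sym (suc-injective ≡1)))
count-unique p ≡1 {suc i} {suc j} pᵢ pⱼ with p zero
... | true  = ⊥-elim (<⇒≢ (count-positive (p ∘ suc) i pᵢ) (sym (suc-injective ≡1)))
... | false = cong suc (count-unique (p ∘ suc) ≡1 pᵢ pⱼ)

count-⊆ : ∀ {n} (p q : Fin n → Bool) → (∀ i → T (p i) → T (q i)) → count p ≤ count q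
count-⊆ {zero}  p q p⊆q = z≤n
count-⊆ {suc n} p q p⊆q with p zero | q zero | p⊆q zero | count-⊆ (p ∘ suc) (q ∘ suc) (p⊆q ∘ suc)
... | true  | true  | _   | ih = s≤s ih
... | true  | false | p⇒q | ih = ⊥-elim (p⇒q tt)
... | false | true  | _   | ih = m≤n⇒m≤1+n ih
... | false | false | _   | ih = ih

count-⊂ : ∀ {n} (p q : Fin n → Bool) → (∀ i → T (p i) → T (q i)) → ∀ i → ¬ T (p i) → T (q i) → count p < count q
count-⊂ p q p⊆q zero ¬pᵢ qᵢ with p zero | q zero
... | true  | _    = ⊥-elim (¬pᵢ tt)
... | false | true = s≤s (count-⊆ (p ∘ suc) (q ∘ suc) (p⊆q ∘ suc))
count-⊂ p q p⊆q (suc i) ¬pᵢ qᵢ with p zero | q zero | p⊆q zero | count-⊂ (p ∘ suc) (q ∘ suc) (p⊆q ∘ suc) i ¬pᵢ qᵢ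
... | true  | true  | _   | ih = s≤s ih
... | true  | false | p⇒q | ih = ⊥-elim (p⇒q tt)
... | false | true  | _   | ih = m≤n⇒m≤1+n ih
... | false | false | _   | ih = ih

digits : ℕ → Bool × Bool
digits zero    = false , false
digits (suc k) = increment (digits k)

degreeDigits≡ : ∀ {n} (A : Matrix n) u → degreeDigits A u ≡ digits (count (A u))
degreeDigits≡ A u = go (A u)
  where
  go : ∀ {n} (p : Fin n → Bool) →
       foldFin (λ v d → when p v then increment d else d) (false , false) ≡ digits (count p)
  go {zero}  p = refl
  go {suc n} p with p zero
  ... | true  = cong increment (go (p ∘ suc))
  ... | false = go (p ∘ suc)

maxOver-≤⁻ : ∀ {n f k} → maxOver n f ≤ k → ∀ i → f i ≤ k
maxOver-≤⁻ {n} {f} max≤ i =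
  ≤-trans (All.tabulate⁻ (All.map⁻ (xs≤max 0 (List.map f (List.allFin n)))) i) max≤

maxOver-≤⁺ : ∀ {n f k} → (∀ i → f i ≤ k) → maxOver n f ≤ k
maxOver-≤⁺ f≤ = max≤v⁺ z≤n (All.map⁺ (All.tabulate⁺ f≤))

module _ {G : Graph} (D : Orientation G) where
  open Graph G
  open Orientation D

  in+out : ∀ v → inDegree D v + outDegree D v ≡ degree G v
  in+out v = sym (count-add _ _ _ split disjoint)
    where
    split : ∀ u → adj v u ≡ arc u v ∨ arc v u
    split u with adj v u in eq | arc u v in uv | arc v u in vu
    ... | true  | true  | _     = refl
    ... | true  | false | true  = refl
    ... | true  | false | false with trans (sym uv) (trans (oneOfBoth v u (from T-≡ eq)) (cong not vu))
    ...   | ()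
    split u | false | true  | _ =
      ⊥-elim (subst T (trans (symmetric u v) eq) (arc⇒adj u v (from T-≡ uv)))
    split u | false | false | true  = ⊥-elim (subst T eq (arc⇒adj v u (from T-≡ vu)))
    split u | false | false | false = refl
    disjoint : ∀ u → T (arc u v) → ¬ T (arc v u)
    disjoint u uv vu = subst T (trans (oneOfBoth v u (arc⇒adj v u vu)) (cong not (to T-≡ vu))) uv

sign : Bool → ℤ
sign true  = + 1
sign false = -[1+ 0 ]

sign-injective : ∀ {a b} → sign a ≡ sign b → a ≡ b
sign-injective {true}  {true}  _ = refl
sign-injective {false} {false} _ = refl

injective⇒surjective : ∀ {n} {f : Fin n → Fin n} → Injective _≡_ _≡_ f → ∀ v → ∃[ u ] f u ≡ v
injective⇒surjective {suc n} {f} f-injective v with Fin.any? (λ u → f u Fin.≟ v)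
... | yes found = found
... | no ¬found = ⊥-elim (1+n≰n (Fin.injective⇒≤ {f = λ u → punchOut (v≢f u)}
                    (λ {x} {y} eq → f-injective (Fin.punchOut-injective (v≢f x) (v≢f y) eq))))
  where
  v≢f : ∀ u → v ≢ f u
  v≢f u v≡ = ¬found (u , sym v≡)

module SmallDegree (G : Graph) (degree≤3 : ∀ v → degree G v ≤ 3) where
  open Graph G hiding (V)

  digit : Fin order → Bool × Bool
  digit = degreeDigits adj

  odd three : Fin order → Bool
  odd v   = isOdd (digit v)
  three v = isThree (digit v)

  H M : Matrix order
  H = oddGraph adj digit
  M = mateGraph adj digit

  data DegreeView (v : Fin order) : Set where
    zeroᵈ  : degree G v ≡ 0 → odd v ≡ false → three v ≡ false → DegreeView v
    oneᵈ   : degree G v ≡ 1 → odd v ≡ true  → three v ≡ false → DegreeView v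
    twoᵈ   : degree G v ≡ 2 → odd v ≡ false → three v ≡ false → DegreeView v
    threeᵈ : degree G v ≡ 3 → odd v ≡ true  → three v ≡ true  → DegreeView v

  degreeView : ∀ v → DegreeView v
  degreeView v with degree G v in deg | degree≤3 v | degreeDigits≡ adj v
  ... | 0 | _ | eq = zeroᵈ  deg (cong isOdd eq) (cong isThree eq)
  ... | 1 | _ | eq = oneᵈ   deg (cong isOdd eq) (cong isThree eq)
  ... | 2 | _ | eq = twoᵈ   deg (cong isOdd eq) (cong isThree eq)
  ... | 3 | _ | eq = threeᵈ deg (cong isOdd eq) (cong isThree eq)
  ... | suc (suc (suc (suc _))) | s≤s (s≤s (s≤s ())) | _

  three⇒odd : ∀ {v} → T (three v) → T (odd v)
  three⇒odd {v} t = proj₂ (to (T-∧ {proj₁ (digit v)}) t)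

  H⁺ : ∀ {u v} → T (adj u v) → T (odd u) → T (odd v) → T (H u v)
  H⁺ uv u v = from T-∧ (uv , from T-∧ (u , v))

  adj-sym : ∀ {u v} → T (adj u v) → T (adj v u)
  adj-sym {u} {v} = subst T (symmetric u v)

  Mated : Fin order → Fin order → Set
  Mated u v = T (adj u v) × T (three u) × T (three v)

  M⁺ : ∀ {u v} → Mated u v → T (M u v)
  M⁺ (uv , u3 , v3) = from T-∨ (inj₁ (from T-∧ (uv , from T-∧ (u3 , v3))))

  M-refl⁺ : ∀ {u} → T (fixable adj digit u) → T (M u u)
  M-refl⁺ {u} fix = from (T-∨ {adj u u ∧ (three u ∧ three u)}) (inj₂ (from T-∧ (from T-≡ (==-refl u) , fix)))

  M⁻ : ∀ {u v} → T (M u v) → Mated u v ⊎ (u ≡ v × T (fixable adj digit u))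
  M⁻ {u} {v} Muv with to (T-∨ {adj u v ∧ (three u ∧ three v)}) Muv
  ... | inj₁ t = let uv , both = to (T-∧ {adj u v}) t
                     u3 , v3 = to (T-∧ {three u}) both in inj₁ (uv , u3 , v3)
  ... | inj₂ t = let eq , fix = to (T-∧ {u == v}) t in inj₂ (==⇒≡ eq , fix)

  fixable⁻ : ∀ {u} → T (three u) → T (fixable adj digit u) → ∃[ v ] (T (adj u v) × ¬ T (odd v))
  fixable⁻ {u} u3 fix with to (T-∨ {not (three u)}) fix
  ... | inj₁ ¬u3 rewrite to T-≡ u3 = ⊥-elim ¬u3
  ... | inj₂ t = let v , t′ = some⁻ _ t
                     uv , ¬v = to (T-∧ {adj u v}) t′ in v , uv , T-not⁻ ¬v

  fixable⁺ : ∀ {u} → (T (three u) → ∃[ v ] (T (adj u v) × ¬ T (odd v))) → T (fixable adj digit u)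
  fixable⁺ {u} even-neighbour with three u
  ... | false = tt
  ... | true  = let v , uv , ¬v = even-neighbour tt in
    some⁺ _ v (from T-∧ (uv , T-not⁺ ¬v))

  Small : Orientation G → ℕ → Set
  Small D k = ∀ v → abs (inOutDegree D v) ≤ k

  -- At a vertex of odd degree with |in - out| ≤ 2 the two degrees differ by
  -- one.  The minor arcs are those of the smaller class: none at a leaf, one
  -- at a vertex of degree three.
  module Necessity (D : Orientation G) (proper : InOutProper D) (small : Small D 2) where
    open Orientation D

    s : Fin order → Bool
    s v = outDegree D v <ᵇ inDegree D v

    minor : Fin order → Fin order → Bool
    minor v w = when s v then arc v w else arc w v

    balance₁ : ∀ i o → i + o ≡ 1 → i ⊖ o ≡ sign (o <ᵇ i) × (when o <ᵇ i then o else i) ≡ 0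
    balance₁ 0 1 refl = refl , refl
    balance₁ 1 0 refl = refl , refl

    balance₃ : ∀ i o → i + o ≡ 3 → abs (i ⊖ o) ≤ 2 →
               i ⊖ o ≡ sign (o <ᵇ i) × (when o <ᵇ i then o else i) ≡ 1
    balance₃ 0 3 refl (s≤s (s≤s ()))
    balance₃ 1 2 refl _ = refl , refl
    balance₃ 2 1 refl _ = refl , refl
    balance₃ 3 0 refl (s≤s (s≤s ()))

    count-minor : ∀ v → count (minor v) ≡ (when s v then outDegree D v else inDegree D v)
    count-minor v with s v
    ... | true  = refl
    ... | false = refl

    value : ∀ v → T (odd v) → inOutDegree D v ≡ sign (s v)
    value v v-odd with degreeView v
    ... | oneᵈ deg _ _   = proj₁ (balance₁ (inDegree D v) (outDegree D v) (trans (in+out D v) deg))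
    ... | threeᵈ deg _ _ = proj₁ (balance₃ (inDegree D v) (outDegree D v) (trans (in+out D v) deg) (small v))
    ... | zeroᵈ _ even _ = ⊥-elim (subst T even v-odd)
    ... | twoᵈ _ even _  = ⊥-elim (subst T even v-odd)

    minor-three : ∀ v → T (three v) → count (minor v) ≡ 1
    minor-three v v3 with degreeView v
    ... | threeᵈ deg _ _ = trans (count-minor v)
      (proj₂ (balance₃ (inDegree D v) (outDegree D v) (trans (in+out D v) deg) (small v)))
    ... | zeroᵈ _ _ ¬3   = ⊥-elim (subst T ¬3 v3)
    ... | oneᵈ _ _ ¬3    = ⊥-elim (subst T ¬3 v3)
    ... | twoᵈ _ _ ¬3    = ⊥-elim (subst T ¬3 v3)

    minor-leaf : ∀ v → T (odd v) → ¬ T (three v) → count (minor v) ≡ 0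
    minor-leaf v v-odd ¬v3 with degreeView v
    ... | oneᵈ deg _ _   = trans (count-minor v)
      (proj₂ (balance₁ (inDegree D v) (outDegree D v) (trans (in+out D v) deg)))
    ... | threeᵈ _ _ v3  = ⊥-elim (¬v3 (from T-≡ v3))
    ... | zeroᵈ _ even _ = ⊥-elim (subst T even v-odd)
    ... | twoᵈ _ even _  = ⊥-elim (subst T even v-odd)

    H⁻ : ∀ {u v} → T (H u v) → T (adj u v) × T (odd u) × T (odd v)
    H⁻ {u} {v} Huv = let uv , oo = to (T-∧ {adj u v}) Huv in uv , to (T-∧ {odd u}) oo

    s-proper : ProperColouring H s
    s-proper u v Huv su≡sv = let uv , u-odd , v-odd = H⁻ Huv in
      proper u v uv (trans (value u u-odd) (trans (cong sign su≡sv) (sym (value v v-odd))))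

    minor⇒adj : ∀ {v w} → T (minor v w) → T (adj v w)
    minor⇒adj {v} {w} t with s v
    ... | true  = arc⇒adj v w t
    ... | false = adj-sym (arc⇒adj w v t)

    -- Adjacent vertices of odd degree have opposite signs, and an arc that leaves one end enters
    -- the other, so it lies in the smaller class at both.
    minor-sym : ∀ {v w} → T (odd v) → T (odd w) → T (minor v w) → T (minor w v)
    minor-sym {v} {w} v-odd w-odd vw = flip (s-proper v w (H⁺ (minor⇒adj vw) v-odd w-odd)) vw
      where
      flip : s v ≢ s w → T (minor v w) → T (minor w v)
      flip ≢ vw with s v | s w
      ... | true  | false = vw
      ... | false | true  = vw
      ... | true  | true  = ⊥-elim (≢ refl)
      ... | false | false = ⊥-elim (≢ refl)

    Partner : Fin order → Fin order → Set
    Partner v w = T (three v) × T (minor v w) × T (three w)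

    mate : ∀ v → ∃[ w ] (Partner v w ⊎ (w ≡ v × (∀ x → ¬ Partner v x)))
    mate v with Fin.any? (λ w → T? (three v) ×-dec (T? (minor v w) ×-dec T? (three w)))
    ... | yes (w , partner) = w , inj₁ partner
    ... | no ¬partner       = v , inj₂ (refl , λ w partner → ¬partner (w , partner))

    f : Fin order → Fin order
    f v = proj₁ (mate v)

    Partner-sym : ∀ {v w} → Partner v w → Partner w v
    Partner-sym (v3 , vw , w3) = w3 , minor-sym (three⇒odd v3) (three⇒odd w3) vw , v3

    f-edge : ∀ v → T (M v (f v))
    f-edge v with mate v
    ... | w , inj₁ (v3 , vw , w3)    = M⁺ (minor⇒adj vw , v3 , w3)
    ... | .v , inj₂ (refl , ¬partner) = M-refl⁺ (fixable⁺ even-neighbour)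
      where
      even-neighbour : T (three v) → ∃[ w ] (T (adj v w) × ¬ T (odd w))
      even-neighbour v3 with count-witness (minor v) (≤-reflexive (sym (minor-three v v3)))
      -- If `w` were odd, the arc would be minor at `w` as well; then `w` is no leaf, so it has
      -- degree three and is a partner.
      ... | w , vw = w , minor⇒adj vw , λ w-odd →
        <⇒≢ (count-positive (minor w) v (minor-sym (three⇒odd v3) w-odd vw))
            (sym (minor-leaf w w-odd λ w3 → ¬partner w (v3 , vw , w3)))

    f-injective : Injective _≡_ _≡_ f
    f-injective {x} {y} fx≡fy with mate x | mate y
    f-injective refl | w , inj₁ xw | .w , inj₁ yw =
      let w3 , wx , _ = Partner-sym xw
          _ , wy , _ = Partner-sym yw in count-unique (minor w) (minor-three w w3) wx wy
    f-injective {x} refl | w , inj₁ xw | .w , inj₂ (refl , ¬partner) = ⊥-elim (¬partner x (Partner-sym xw))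
    f-injective {y = y} refl | w , inj₂ (refl , ¬partner) | .w , inj₁ yw = ⊥-elim (¬partner y (Partner-sym yw))
    f-injective refl | w , inj₂ (refl , _) | .w , inj₂ (refl , _) = refl

    accepted : T (accepts adj)
    accepted = from T-∧ (isProper⁺ H _ (labelling-proper H s s-proper) ,
                         isPerfect⁺ M _ (auction-covers M f f-injective f-edge))

-- With `m` arcs in the smaller class out of 2m + 1, the other class has m + 1. It is used with m =
-- 0 at leaves and m = 1 at degree three.
value-of-minor : ∀ b m {i o} → (when b then o else i) ≡ m → i + o ≡ suc (m + m) → i ⊖ o ≡ sign b
value-of-minor true m {i} refl sum≡ rewrite +-cancelʳ-≡ m i (suc m) sum≡ =
  trans (ℤ.⊖-≥ (n≤1+n m)) (cong +_ (m+n∸n≡m 1 m))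
value-of-minor false m {i} {o} refl sum≡
  rewrite +-cancelˡ-≡ m o (suc m) (trans sum≡ (sym (+-suc m m))) =
  trans (ℤ.⊖-< (n<1+n m)) (cong (λ k → - (+ k)) (m+n∸n≡m 1 m))

even≢sign : ∀ i o b → i + o ≡ 0 ⊎ i + o ≡ 2 → i ⊖ o ≢ sign b
even≢sign 0 0 true  (inj₁ refl) ()
even≢sign 0 0 false (inj₁ refl) ()
even≢sign 0 2 true  (inj₂ refl) ()
even≢sign 0 2 false (inj₂ refl) ()
even≢sign 1 1 true  (inj₂ refl) ()
even≢sign 1 1 false (inj₂ refl) ()
even≢sign 2 0 true  (inj₂ refl) ()
even≢sign 2 0 false (inj₂ refl) ()

even-small : ∀ i o → i + o ≡ 0 ⊎ i + o ≡ 2 → abs (i ⊖ o) ≤ 2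
even-small 0 0 (inj₁ refl) = z≤n
even-small 0 2 (inj₂ refl) = ≤-refl
even-small 1 1 (inj₂ refl) = z≤n
even-small 2 0 (inj₂ refl) = ≤-refl

-- At degree two the tail of an arc has value 0 or -2 and the head 0 or 2, so a common value can
-- only be 0.
tail-head-balanced : ∀ i o i′ o′ → i + o ≡ 2 → i′ + o′ ≡ 2 → 0 < o → 0 < i′ →
                     i ⊖ o ≡ i′ ⊖ o′ → i ≡ o × i′ ≡ o′
tail-head-balanced 1 1 1 1 refl refl _ _ _ = refl , refl
tail-head-balanced 0 2 1 1 refl refl _ _ ()
tail-head-balanced 0 2 2 0 refl refl _ _ ()
tail-head-balanced 1 1 2 0 refl refl _ _ ()
tail-head-balanced 2 0 _ _ refl _ () _ _
tail-head-balanced _ _ 0 _ _ _ _ () _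

-- From colourings and matchings to orientations

module Flip {G : Graph} (D : Orientation G) {a b : Graph.V G} (ab : T (Orientation.arc D a b)) where
  open Graph G hiding (V)
  open Orientation D

  a≢b : a ≢ b
  a≢b refl = subst T (irreflexive a) (arc⇒adj a a ab)

  ba : arc b a ≡ false
  ba = trans (oneOfBoth a b (arc⇒adj a b ab)) (cong not (to T-≡ ab))

  flipped : Fin order → Fin order → Bool
  flipped u v = when (u == a) ∧ (v == b) then false else (when (u == b) ∧ (v == a) then true else arc u v)

  flipped-ab : flipped a b ≡ false
  flipped-ab rewrite ==-refl a | ==-refl b = refl

  flipped-ba : flipped b a ≡ true
  flipped-ba rewrite ≢⇒== (a≢b ∘ sym) | ==-refl b | ==-refl a = refl

  ==-∧-false : ∀ {u v x y : Fin order} → u ≢ x ⊎ v ≢ y → ((u == x) ∧ (v == y)) ≡ false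
  ==-∧-false (inj₁ u≢x) rewrite ≢⇒== u≢x = refl
  ==-∧-false {u} {x = x} (inj₂ v≢y) rewrite ≢⇒== v≢y = Bool.∧-zeroʳ (u == x)

  flipped-other : ∀ {u v} → u ≢ a ⊎ v ≢ b → u ≢ b ⊎ v ≢ a → flipped u v ≡ arc u v
  flipped-other {u} {v} ≢ab ≢ba rewrite ==-∧-false {u} {v} ≢ab | ==-∧-false {u} {v} ≢ba = refl

  data Position (u v : Fin order) : Set where
    forward  : u ≡ a → v ≡ b → Position u v
    backward : u ≡ b → v ≡ a → Position u v
    other    : flipped u v ≡ arc u v → flipped v u ≡ arc v u → Position u v

  position : ∀ u v → Position u v
  position u v with u Fin.≟ a | v Fin.≟ b | u Fin.≟ b | v Fin.≟ a
  ... | yes u≡a | yes v≡b | _ | _ = forward u≡a v≡b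
  ... | _ | _ | yes u≡b | yes v≡a = backward u≡b v≡a
  ... | no u≢a | _ | no u≢b | _ = other (flipped-other (inj₁ u≢a) (inj₁ u≢b)) (flipped-other (inj₂ u≢b) (inj₂ u≢a))
  ... | no u≢a | _ | yes _ | no v≢a = other (flipped-other (inj₁ u≢a) (inj₂ v≢a)) (flipped-other (inj₁ v≢a) (inj₂ u≢a))
  ... | yes _ | no v≢b | no u≢b | _ = other (flipped-other (inj₂ v≢b) (inj₁ u≢b)) (flipped-other (inj₂ u≢b) (inj₁ v≢b))
  ... | yes _ | no v≢b | yes _ | no v≢a = other (flipped-other (inj₂ v≢b) (inj₂ v≢a)) (flipped-other (inj₁ v≢a) (inj₁ v≢b))

  D′ : Orientation G
  D′ = record { arc = flipped ; arc⇒adj = arc′⇒adj ; oneOfBoth = oneOfBoth′ }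
    where
    arc′⇒adj : ∀ u v → T (flipped u v) → T (adj u v)
    arc′⇒adj u v uv with position u v
    ... | forward refl refl  = ⊥-elim (subst T flipped-ab uv)
    ... | backward refl refl = subst T (symmetric a b) (arc⇒adj a b ab)
    ... | other eq _         = arc⇒adj u v (subst T eq uv)
    oneOfBoth′ : ∀ u v → T (adj u v) → flipped v u ≡ not (flipped u v)
    oneOfBoth′ u v uv with position u v
    ... | forward refl refl  = trans flipped-ba (cong not (sym flipped-ab))
    ... | backward refl refl = trans flipped-ab (cong not (sym flipped-ba))
    ... | other eq eq′       = trans eq′ (trans (oneOfBoth u v uv) (cong not (sym eq)))

  out-a : outDegree D a ≡ suc (outDegree D′ a)
  out-a = count-insert (flipped a) (arc a) b flipped-ab (to T-≡ ab)
    λ j j≢b → sym (flipped-other (inj₂ j≢b) (inj₁ a≢b))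

  in-a : inDegree D′ a ≡ suc (inDegree D a)
  in-a = count-insert (λ u → arc u a) (λ u → flipped u a) b ba flipped-ba
    λ j j≢b → flipped-other (inj₂ a≢b) (inj₁ j≢b)

  in-other : ∀ {v} → v ≢ a → v ≢ b → inDegree D′ v ≡ inDegree D v
  in-other {v} v≢a v≢b = count-cong λ u → flipped-other {u} {v} (inj₂ v≢b) (inj₂ v≢a)

  out-other : ∀ {v} → v ≢ a → v ≢ b → outDegree D′ v ≡ outDegree D v
  out-other {v} v≢a v≢b = count-cong λ u → flipped-other {v} {u} (inj₁ v≢a) (inj₁ v≢b)

<ᵇ-flip : ∀ m n → m ≢ n → (n <ᵇ m) ≡ not (m <ᵇ n)
<ᵇ-flip zero    zero    m≢n = ⊥-elim (m≢n refl)
<ᵇ-flip zero    (suc n) m≢n = refl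
<ᵇ-flip (suc m) zero    m≢n = refl
<ᵇ-flip (suc m) (suc n) m≢n = <ᵇ-flip m n (m≢n ∘ cong suc)

-- An end of odd degree decides the direction of an edge, the first one if both are odd; `d` is the
-- default between two even ends. Reversing the ends is consistent only if two odd ends agree.
choose : (a b first second d : Bool) → Bool
choose a b first second d = when a then first else (when b then not second else d)

choose-flip : ∀ a b p q d e → (T a → T b → q ≡ not p) → e ≡ not d →
              choose b a q p e ≡ not (choose a b p q d)
choose-flip true  true  p q d e q≡ e≡ = q≡ tt tt
choose-flip true  false p q d e q≡ e≡ = refl
choose-flip false true  p q d e q≡ e≡ = sym (Bool.not-involutive q)
choose-flip false false p q d e q≡ e≡ = e≡

module Sufficiency (G : Graph) (degree≤3 : ∀ v → degree G v ≤ 3) where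
  open Graph G hiding (V)
  open SmallDegree G degree≤3

  irreflexive′ : ∀ {v} → ¬ T (adj v v)
  irreflexive′ {v} = subst T (irreflexive v)

  module _ (c : Fin order → Bool) (c-proper : ProperColouring H c) (o : Owners order) (covers : Covers M o) where

    g : Fin order → Fin order
    g u = proj₁ (covers u)

    g-injective : Injective _≡_ _≡_ g
    g-injective {x} {y} gx≡gy = cong proj₂ (trans (sym (proj₁ (proj₂ (covers x))))
                                  (trans (cong o gx≡gy) (proj₁ (proj₂ (covers y)))))

    g⁻¹ : Fin order → Fin order
    g⁻¹ v = proj₁ (injective⇒surjective g-injective v)

    g∘g⁻¹ : ∀ v → g (g⁻¹ v) ≡ v
    g∘g⁻¹ v = proj₂ (injective⇒surjective g-injective v)

    -- Keeps the edges from `v` to `g v` with `c v` true: every second edge of each nontrivial cycle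
    -- of `g`, seen from both of its ends.
    τ : Fin order → Fin order
    τ v = when c v then g v else g⁻¹ v

    τ-edge : ∀ v → Mated v (τ v) ⊎ (τ v ≡ v × T (fixable adj digit v))
    τ-edge v with c v
    ... | true with M⁻ (proj₂ (proj₂ (covers v)))
    ...   | inj₁ mated        = inj₁ mated
    ...   | inj₂ (v≡gv , fix) = inj₂ (sym v≡gv , fix)
    τ-edge v | false with M⁻ (subst (λ w → T (M (g⁻¹ v) w)) (g∘g⁻¹ v) (proj₂ (proj₂ (covers (g⁻¹ v)))))
    ...   | inj₁ (uv , u3 , v3) = inj₁ (adj-sym uv , v3 , u3)
    ...   | inj₂ (eq , fix)     = inj₂ (eq , subst (T ∘ fixable adj digit) eq fix)

    τ-swap : ∀ {v w} → T (H v w) → τ v ≡ w → τ w ≡ v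
    τ-swap {v} {w} Hvw τv≡w with c v | c w | c-proper v w Hvw
    ... | true  | true  | ≢ = ⊥-elim (≢ refl)
    ... | false | false | ≢ = ⊥-elim (≢ refl)
    ... | true  | false | _ = g-injective (trans (g∘g⁻¹ w) (sym τv≡w))
    ... | false | true  | _ = trans (cong g (sym τv≡w)) (g∘g⁻¹ v)

    -- The other end of the minor arc at v, or v itself if there is no such arc.
    data Mate (v w : Fin order) : Set where
      paired : Mated v w → τ v ≡ w → Mate v w
      fixed  : T (three v) → τ v ≡ v → T (adj v w) → ¬ T (odd w) → Mate v w
      none   : ¬ T (three v) → w ≡ v → Mate v w

    mate : ∀ v → ∃[ w ] Mate v w
    mate v with T? (three v)
    ... | no ¬v3 = v , none ¬v3 refl
    ... | yes v3 with τ-edge v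
    ...   | inj₁ mated        = τ v , paired mated refl
    ...   | inj₂ (τv≡v , fix) = let w , vw , even = fixable⁻ v3 fix in w , fixed v3 τv≡v vw even

    μ : Fin order → Fin order
    μ v = proj₁ (mate v)

    -- Two adjacent vertices of odd degree have to agree on whether their edge is minor, as
    -- otherwise they would demand opposite directions.
    Mate-sym : ∀ {v w x} → T (adj v w) → T (odd v) → T (odd w) → Mate v w → Mate w x → x ≡ v
    Mate-sym vw v-odd w-odd (paired _ τv≡w) (paired _ τw≡x) = trans (sym τw≡x) (τ-swap (H⁺ vw v-odd w-odd) τv≡w)
    Mate-sym {v} vw v-odd w-odd (paired _ τv≡w) (fixed _ τw≡w _ _) =
      ⊥-elim (irreflexive′ (subst (T ∘ adj v) (trans (sym τw≡w) (τ-swap (H⁺ vw v-odd w-odd) τv≡w)) vw))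
    Mate-sym vw v-odd w-odd (paired (_ , _ , w3) _) (none ¬w3 _) = ⊥-elim (¬w3 w3)
    Mate-sym vw v-odd w-odd (fixed _ _ _ even) _ = ⊥-elim (even w-odd)
    Mate-sym vw v-odd w-odd (none _ refl) _ = ⊥-elim (irreflexive′ vw)

    μ-sym : ∀ {v w} → T (adj v w) → T (odd v) → T (odd w) → w ≡ μ v → v ≡ μ w
    μ-sym {v} {w} vw v-odd w-odd refl = sym (Mate-sym vw v-odd w-odd (proj₂ (mate v)) (proj₂ (mate w)))

    μ-== : ∀ {v w} → T (adj v w) → T (odd v) → T (odd w) → (v == μ w) ≡ (w == μ v)
    μ-== {v} {w} vw v-odd w-odd with w Fin.≟ μ v
    ... | no w≢  = trans (≢⇒== (w≢ ∘ μ-sym (adj-sym vw) w-odd v-odd)) (sym (≢⇒== w≢))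
    ... | yes w≡ = trans (≡⇒== (μ-sym vw v-odd w-odd w≡)) (sym (≡⇒== w≡))
      where
      ≡⇒== : ∀ {i j : Fin order} → i ≡ j → (i == j) ≡ true
      ≡⇒== {i} refl = ==-refl i

    -- Tells whether `v` wants the edge to leave towards `w`: with colour `true` only the minor arc
    -- leaves, with `false` only the minor arc enters. A leaf has `μ v ≡ v`, so its edge is never
    -- minor.
    prefers : Matrix order
    prefers v w = when c v then (w == μ v) else not (w == μ v)

    prefers-flip : ∀ {u v} → T (adj u v) → T (odd u) → T (odd v) → prefers v u ≡ not (prefers u v)
    prefers-flip {u} {v} uv u-odd v-odd =
      trans (cong₂ (λ b x → when b then x else not x)
                   (¬-not (c-proper v u (H⁺ (adj-sym uv) v-odd u-odd))) (sym (μ-== (adj-sym uv) v-odd u-odd)))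
            (negated (c u) (v == μ u))
      where
      negated : ∀ b x → (when not b then x else not x) ≡ not (when b then x else not x)
      negated true  x = refl
      negated false x = sym (Bool.not-involutive x)

    direction : Matrix order
    direction u v = choose (odd u) (odd v) (prefers u v) (prefers v u) (toℕ u <ᵇ toℕ v)

    direction-flip : ∀ u v → T (adj u v) → direction v u ≡ not (direction u v)
    direction-flip u v uv = choose-flip (odd u) (odd v) (prefers u v) (prefers v u) _ _
      (prefers-flip uv)
      (<ᵇ-flip _ _ λ eq → irreflexive′ (subst (T ∘ adj u) (sym (Fin.toℕ-injective eq)) uv))

    D₀ : Orientation G
    D₀ = record
      { arc       = λ u v → adj u v ∧ direction u v
      ; arc⇒adj   = λ u v → proj₁ ∘ to (T-∧ {adj u v})
      ; oneOfBoth = λ u v uv → trans (cong₂ _∧_ (to T-≡ (adj-sym uv)) (direction-flip u v uv))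
                                     (cong (λ x → not (x ∧ direction u v)) (sym (to T-≡ uv)))
      }

    toMate : Fin order → Fin order → Bool
    toMate v w = adj v w ∧ (w == μ v)

    count-toMate : ∀ v → T (odd v) → (when c v then outDegree D₀ v else inDegree D₀ v) ≡ count (toMate v)
    count-toMate v v-odd = cases (c v) refl
      where
      direction≡ : ∀ w → direction v w ≡ prefers v w
      direction≡ w = cong (λ a → choose a (odd w) (prefers v w) (prefers w v) (toℕ v <ᵇ toℕ w)) (to T-≡ v-odd)

      prefers≡ : ∀ {b} → c v ≡ b → ∀ w → prefers v w ≡ (when b then (w == μ v) else not (w == μ v))
      prefers≡ cv w = cong (λ b → when b then (w == μ v) else not (w == μ v)) cv

      in≡ : c v ≡ false → ∀ w → adj w v ∧ direction w v ≡ toMate v w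
      in≡ cv w = trans (cong (_∧ direction w v) (symmetric w v)) (∧-cong (adj v w) λ vw →
        trans (direction-flip v w vw)
              (trans (cong not (trans (direction≡ w) (prefers≡ cv w))) (Bool.not-involutive (w == μ v))))
        where
        ∧-cong : ∀ a {x y} → (T a → x ≡ y) → a ∧ x ≡ a ∧ y
        ∧-cong true  x≡y = x≡y tt
        ∧-cong false x≡y = refl

      cases : ∀ b → c v ≡ b → (when b then outDegree D₀ v else inDegree D₀ v) ≡ count (toMate v)
      cases true  cv = count-cong λ w → cong (adj v w ∧_) (trans (direction≡ w) (prefers≡ cv w))
      cases false cv = count-cong (in≡ cv)

    toMate-three : ∀ v → T (three v) → count (toMate v) ≡ 1
    toMate-three v v3 = count-single (toMate v) (μ v) (from T-∧ (adj-mate (proj₂ (mate v)) , from T-≡ (==-refl (μ v))))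
                          λ w t → ==⇒≡ (proj₂ (to (T-∧ {adj v w}) t))
      where
      adj-mate : ∀ {w} → Mate v w → T (adj v w)
      adj-mate (paired (vw , _) _) = vw
      adj-mate (fixed _ _ vw _)    = vw
      adj-mate (none ¬v3 _)        = ⊥-elim (¬v3 v3)

    toMate-leaf : ∀ v → ¬ T (three v) → count (toMate v) ≡ 0
    toMate-leaf v ¬v3 = count-none (toMate v) λ w t → let vw , w≡μv = to (T-∧ {adj v w}) t in
      irreflexive′ (subst (T ∘ adj v) (trans (==⇒≡ w≡μv) (no-mate (proj₂ (mate v)))) vw)
      where
      no-mate : ∀ {w} → Mate v w → w ≡ v
      no-mate (paired (_ , v3 , _) _) = ⊥-elim (¬v3 v3)
      no-mate (fixed v3 _ _ _)        = ⊥-elim (¬v3 v3)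
      no-mate (none _ w≡v)            = w≡v

    Coloured : Orientation G → Set
    Coloured D = ∀ v → T (odd v) → inOutDegree D v ≡ sign (c v)

    D₀-coloured : Coloured D₀
    D₀-coloured v v-odd with degreeView v
    ... | zeroᵈ _ even _ = ⊥-elim (subst T even v-odd)
    ... | twoᵈ _ even _  = ⊥-elim (subst T even v-odd)
    ... | oneᵈ deg _ ¬v3 = value-of-minor (c v) 0
      (trans (count-toMate v v-odd) (toMate-leaf v (subst T ¬v3))) (trans (in+out D₀ v) deg)
    ... | threeᵈ deg _ v3 = value-of-minor (c v) 1
      (trans (count-toMate v v-odd) (toMate-three v (from T-≡ v3))) (trans (in+out D₀ v) deg)

    idle : Orientation G → Fin order → Bool
    idle D v = not (odd v) ∧ (inDegree D v ≡ᵇ outDegree D v)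

    idle⁻ : ∀ D {v} → T (idle D v) → ¬ T (odd v) × inDegree D v ≡ outDegree D v
    idle⁻ D {v} t = let ¬odd , eq = to (T-∧ {not (odd v)}) t in
      T-not⁻ ¬odd , ≡ᵇ⇒≡ _ _ eq

    -- Value 0 is the only one that adjacent vertices of even degree can share, so this is
    -- properness between such vertices.
    Settled : Orientation G → Set
    Settled D = ∀ a b → T (Orientation.arc D a b) → T (idle D a) → ¬ T (idle D b)

    -- Reversing an arc between two idle vertices makes both of them busy and
    -- changes no other vertex.
    settle : ∀ m D → Coloured D → count (idle D) < m → Σ[ D′ ∈ Orientation G ] (Coloured D′ × Settled D′)
    settle (suc m) D coloured (s≤s count≤)
      with Fin.any? (λ a → Fin.any? (λ b → T? (Orientation.arc D a b) ×-dec (T? (idle D a) ×-dec T? (idle D b))))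
    ... | no settled = D , coloured , λ a b ab a-idle b-idle → settled (a , b , ab , a-idle , b-idle)
    ... | yes (a , b , ab , a-idle , b-idle) =
      settle m D′ coloured′ (<-≤-trans (count-⊂ (idle D′) (idle D) idle-⊆ a ¬a-idle a-idle) count≤)
      where
      open Flip D ab

      a-balanced = proj₂ (idle⁻ D a-idle)

      ¬a-idle : ¬ T (idle D′ a)
      -- After the reversal the in-degree of `a` exceeds its out-degree by two.
      ¬a-idle t = <⇒≢ (m≤n⇒m≤1+n ≤-refl) (sym (trans (sym (trans in-a (cong suc (trans a-balanced out-a)))) (proj₂ (idle⁻ D′ t))))

      coloured′ : Coloured D′
      coloured′ v v-odd with v Fin.≟ a | v Fin.≟ b
      ... | yes refl | _        = ⊥-elim (proj₁ (idle⁻ D a-idle) v-odd)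
      ... | _        | yes refl = ⊥-elim (proj₁ (idle⁻ D b-idle) v-odd)
      ... | no v≢a   | no v≢b   = trans (cong₂ _⊖_ (in-other v≢a v≢b) (out-other v≢a v≢b)) (coloured v v-odd)

      idle-⊆ : ∀ v → T (idle D′ v) → T (idle D v)
      idle-⊆ v t with v Fin.≟ a | v Fin.≟ b
      ... | yes refl | _        = a-idle
      ... | _        | yes refl = b-idle
      ... | no v≢a   | no v≢b   =
        subst T (cong (not (odd v) ∧_) (cong₂ _≡ᵇ_ (in-other v≢a v≢b) (out-other v≢a v≢b))) t

    even-sum : ∀ (D : Orientation G) v → ¬ T (odd v) → inDegree D v + outDegree D v ≡ 0 ⊎ inDegree D v + outDegree D v ≡ 2
    even-sum D v even with degreeView v
    ... | zeroᵈ deg _ _    = inj₁ (trans (in+out D v) deg)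
    ... | twoᵈ deg _ _     = inj₂ (trans (in+out D v) deg)
    ... | oneᵈ _ v-odd _   = ⊥-elim (even (from T-≡ v-odd))
    ... | threeᵈ _ v-odd _ = ⊥-elim (even (from T-≡ v-odd))

    arc-unequal : ∀ D → Settled D → ∀ u v → ¬ T (odd u) → ¬ T (odd v) → T (Orientation.arc D u v) →
                  inOutDegree D u ≢ inOutDegree D v
    arc-unequal D settled u v u-even v-even uv eq
      with even-sum D u u-even | even-sum D v v-even
         | count-positive (Orientation.arc D u) v uv | count-positive (λ w → Orientation.arc D w v) u uv
    ... | inj₁ sum≡0 | _ | 0<out | _ = <⇒≢ 0<out (sym (m+n≡0⇒n≡0 (inDegree D u) sum≡0))
    ... | inj₂ _ | inj₁ sum≡0 | _ | 0<in = <⇒≢ 0<in (sym (m+n≡0⇒m≡0 (inDegree D v) sum≡0))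
    ... | inj₂ u≡2 | inj₂ v≡2 | 0<out | 0<in
      with tail-head-balanced (inDegree D u) (outDegree D u) (inDegree D v) (outDegree D v) u≡2 v≡2 0<out 0<in eq
    ...   | u≡ , v≡ = settled u v uv (idle⁺ u-even u≡) (idle⁺ v-even v≡)
      where
      idle⁺ : ∀ {w} → ¬ T (odd w) → inDegree D w ≡ outDegree D w → T (idle D w)
      idle⁺ {w} even eq = from T-∧ (T-not⁺ even , ≡⇒≡ᵇ _ _ eq)

    settled-proper : ∀ D → Coloured D → Settled D → InOutProper D
    settled-proper D coloured settled u v uv eq with T? (odd u) | T? (odd v)
    ... | yes u-odd | yes v-odd = c-proper u v (H⁺ uv u-odd v-odd)
      (sign-injective (trans (sym (coloured u u-odd)) (trans eq (coloured v v-odd))))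
    ... | yes u-odd | no v-even = even≢sign (inDegree D v) (outDegree D v) (c u) (even-sum D v v-even) (trans (sym eq) (coloured u u-odd))
    ... | no u-even | yes v-odd = even≢sign (inDegree D u) (outDegree D u) (c v) (even-sum D u u-even) (trans eq (coloured v v-odd))
    ... | no u-even | no v-even with Orientation.arc D u v in arc-uv
    ...   | true  = arc-unequal D settled u v u-even v-even (from T-≡ arc-uv) eq
    ...   | false = arc-unequal D settled v u v-even u-even
      (from T-≡ (trans (Orientation.oneOfBoth D u v uv) (cong not arc-uv))) (sym eq)

    coloured-small : ∀ D → Coloured D → Small D 2
    coloured-small D coloured v with T? (odd v)
    ... | no even = even-small (inDegree D v) (outDegree D v) (even-sum D v even)
    ... | yes v-odd rewrite coloured v v-odd with c v
    ...   | true  = s≤s z≤n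
    ...   | false = s≤s z≤n

    orientation : Σ[ D ∈ Orientation G ] (InOutProper D × Small D 2)
    orientation = let D , coloured , settled = settle _ D₀ D₀-coloured ≤-refl in
      D , settled-proper D coloured settled , coloured-small D coloured

-- Attaining the minimum

Orientable : Graph → ℕ → Set
Orientable G k = Σ[ D ∈ Orientation G ] (InOutProper D × (∀ v → abs (inOutDegree D v) ≤ k))

-- To exhibit the minimum constructively, one has to decide whether a smaller bound is attained. The
-- search over all sets of ordered pairs serves only the proof; the program never performs it.
orientable? : ∀ G k → Dec (Orientable G k)
orientable? G k = map′ fromMatrix toMatrix (anySubset? λ S → admissible? (matrixOf S))
  where
  open Graph G hiding (V)

  balance : Matrix order → Fin order → ℤ
  balance B v = count (λ u → B u v) ⊖ count (B v)

  Admissible : Matrix order → Set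
  Admissible B = (∀ u v → T (B u v) → T (adj u v)) × (∀ u v → T (adj u v) → B v u ≡ not (B u v)) ×
                 (∀ u v → T (adj u v) → balance B u ≢ balance B v) × (∀ v → abs (balance B v) ≤ k)

  admissible? : ∀ B → Dec (Admissible B)
  admissible? B =
    Fin.all? (λ u → Fin.all? λ v → T? (B u v) →-dec T? (adj u v)) ×-dec
    Fin.all? (λ u → Fin.all? λ v → T? (adj u v) →-dec (B v u Bool.≟ not (B u v))) ×-dec
    Fin.all? (λ u → Fin.all? λ v → T? (adj u v) →-dec ¬? (balance B u ℤ.≟ balance B v)) ×-dec
    Fin.all? (λ v → abs (balance B v) ≤? k)

  matrixOf : Subset (order * order) → Matrix order
  matrixOf S u v = lookup S (combine u v)

  fromMatrix : ∃[ S ] Admissible (matrixOf S) → Orientable G k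
  fromMatrix (S , ⊆adj , one , proper , small) =
    record { arc = matrixOf S ; arc⇒adj = ⊆adj ; oneOfBoth = one } , proper , small

  toMatrix : Orientable G k → ∃[ S ] Admissible (matrixOf S)
  toMatrix (D , proper , small) = S ,
    (λ u v → arc⇒adj u v ∘ subst T (S≡ u v)) ,
    (λ u v uv → trans (S≡ v u) (trans (oneOfBoth u v uv) (cong not (sym (S≡ u v))))) ,
    (λ u v uv eq → proper u v uv (trans (sym (balance≡ u)) (trans eq (balance≡ v)))) ,
    (λ v → subst (λ z → abs z ≤ k) (sym (balance≡ v)) (small v))
    where
    open Orientation D
    S = tabulate (λ i → arc (proj₁ (remQuot {order} order i)) (proj₂ (remQuot {order} order i)))
    S≡ : ∀ u v → matrixOf S u v ≡ arc u v
    S≡ u v = trans (Vec.lookup∘tabulate _ (combine u v))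
                   (cong (λ x → arc (proj₁ x) (proj₂ x)) (Fin.remQuot-combine u v))
    balance≡ : ∀ v → balance (matrixOf S) v ≡ inOutDegree D v
    balance≡ v = cong₂ _⊖_ (count-cong λ u → S≡ u v) (count-cong λ u → S≡ v u)

-- The property speaks of the minimum itself. It is reached by lowering `k` while the next smaller
-- bound is attainable; the first failure excludes all lower bounds, because `Orientable G` is
-- monotone in the bound.
orientationNumber : ∀ G k → Orientable G k → ∃[ j ] (IsInOutProperOrientationNumber G j × j ≤ k)
orientationNumber G k orientable = least k orientable
  where
  bounded : ∀ {D : Orientation G} {j} → maxInOutDegree D ≤ j → ∀ v → abs (inOutDegree D v) ≤ j
  bounded = maxOver-≤⁻

  number : ∀ j → Orientable G j → (∀ i → i < j → ¬ Orientable G i) → IsInOutProperOrientationNumber G j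
  number j (D , proper , small) ¬smaller = record
    { attained = D , proper , ≤-antisym (maxOver-≤⁺ small) (minimal D proper)
    ; minimal  = minimal
    }
    where
    minimal : (D : Orientation G) → InOutProper D → j ≤ maxInOutDegree D
    minimal D proper = ≮⇒≥ λ max<j → ¬smaller _ max<j (D , proper , bounded {D} ≤-refl)

  least : ∀ k → Orientable G k → ∃[ j ] (IsInOutProperOrientationNumber G j × j ≤ k)
  least zero    q = zero , number zero q (λ _ ()) , z≤n
  least (suc k) q with orientable? G k
  ... | yes q′ = let j , isNumber , j≤k = least k q′ in j , isNumber , m≤n⇒m≤1+n j≤k
  ... | no ¬q  = suc k , number (suc k) q ¬smaller , ≤-refl
    where
    ¬smaller : ∀ i → i < suc k → ¬ Orientable G i
    ¬smaller i (s≤s i≤k) (D , proper , small) = ¬q (D , proper , λ v → ≤-trans (small v) i≤k)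

accepts-sound : ∀ G → maxDegree G ≡ 3 → T (accepts (Graph.adj G)) → Orientable G 2
accepts-sound G max≡3 accepted =
  orientation c (isProper⁻ H c (proj₁ checks)) o (isPerfect⁻ M o (proj₂ checks))
  where
  degree≤3 = maxOver-≤⁻ (≤-reflexive max≡3)
  open SmallDegree G degree≤3
  open Sufficiency G degree≤3
  c = proj₂ (labelling H)
  o = proj₁ (auction M)
  checks : T (isProper H c) × T (isPerfect M o)
  checks = to (T-∧ {isProper H c}) accepted

accepts-complete : ∀ G → maxDegree G ≡ 3 → Orientable G 2 → T (accepts (Graph.adj G))
accepts-complete G max≡3 (D , proper , small) = Necessity.accepted D proper small
  where open SmallDegree G (maxOver-≤⁻ (≤-reflexive max≡3))

number≤⇒orientable : ∀ {G k l} → IsInOutProperOrientationNumber G k → k ≤ l → Orientable G l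
number≤⇒orientable number k≤l =
  let D , proper , max≡k = IsInOutProperOrientationNumber.attained number in
  D , proper , maxOver-≤⁻ (≤-trans (≤-reflexive max≡k) k≤l)

accepts-reflects : ∀ G → maxDegree G ≡ 3 →
  Reflects (∃[ k ] (IsInOutProperOrientationNumber G k × k ≤ 2)) (accepts (Graph.adj G))
accepts-reflects G max≡3 = fromEquivalence
  (λ accepted → orientationNumber G 2 (accepts-sound G max≡3 accepted))
  (λ (k , number , k≤2) → accepts-complete G max≡3 (number≤⇒orientable number k≤2))

theorem3 : PolynomialTimeDecidable
    (λ G → maxDegree G ≡ 3)
    (λ G → ∃[ k ] (IsInOutProperOrientationNumber G k × k ≤ 2))
theorem3 = decidable-by-term acceptsᵗ λ G max≡3 →
  subst (Reflects _) (sym (acceptsᵗ≡ (Graph.adj G))) (accepts-reflects G max≡3)
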